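{- Let $\sigma$ be a signature and let $q,k,d\in\mathbb{N}$. Every $\varphi\in\mathsf{FO}^+(q,k,d)$ is equivalent (on all $\sigma$-structures) to a formula $\varphi'$ in Gaifman normal form for $\mathsf{FO}^+(q,k,d)$, i.e. a Boolean combination of local formulas in $\mathsf{FO}^+(q,k,d)$ and basic local sentences for $\mathsf{FO}^+(q,k,d)$. Furthermore, $\varphi'$ can be chosen such that: 1. $\mathrm{free}(\varphi')=\mathrm{free}(\varphi)$; 2. the outer quantifier rank of $\varphi'$ is at most $\mathrm{qr}(\varphi)$ and its inner quantifier rank is at most $\mathrm{qr}(\varphi)-1$; 3. the outer radius of $\varphi'$ is at most $\mathrm{r}_1(q,k,d)$ and its inner radius is at most $\mathrm{r}_1(q-1,k+1,d)$; 4. the width of $\varphi'$ is at most $k+q$ and its inner distance is at most $\mathrm{r}_1(q,k,d)+2\,\mathrm{r}_1(q-1,k+1,d)$. Moreover, such a $\varphi'$ can be computed from $\varphi,q,k,d$.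
   Context: A signature $\sigma$ is a finite set of relation symbols with arities in $\mathbb N$ (arity 0 allowed); $\sigma$-structures are relational with finite non-empty universe. The Gaifman graph of $\mathcal A$ has vertex set $A$ and an edge between distinct $a,b$ iff both occur in a common tuple of some relation of $\mathcal A$; $\mathrm{dist}^{\mathcal A}$ is the distance in it ($\infty$ if disconnected). For a non-empty tuple $\bar a$, $\mathcal N_r^{\mathcal A}(\bar a)$ is the induced substructure on the set of elements at distance $\le r$ from some entry of $\bar a$. $\mathsf{FO}^+$ is first-order logic (with atoms $\mathsf{true},\mathsf{false}$, equalities, relational atoms) extended by distance atoms $\mathrm{dist}(x,y)\le d$ for constants $d\in\mathbb N$, with the obvious semantics. $\mathrm{qr}(\varphi)$ is the maximum nesting depth of quantifiers (distance atoms are quantifier-free); $\mathrm{md}(\varphi)$ is the least $r\in\mathbb N$ such that $r'\le r$ for all distance atoms $\mathrm{dist}(x,y)\le r'$ in $\varphi$. $\mathrm{dist}(x,y)>r$ abbreviates $\neg\,\mathrm{dist}(x,y)\le r$. A formula $\varphi$ is $r$-local if for some non-empty tuple $\bar x$ of variables containing all its free variables, all structures $\mathcal A$ and all $\bar a\in A^{|\bar x|}$: $\mathcal A\models\varphi(\bar a)\iff\mathcal N_r^{\mathcal A}(\bar a)\models\varphi(\bar a)$; it is local if it is $r$-local for some $r\in\mathbb N$. Radius function: $\mathrm r_1(0,k,d)=\max\{d,1\}$, $\mathrm r_1(q+1,k,d)=4k\cdot\mathrm r_1(q,k+1,d)$ for $q,k,d\in\mathbb N$. Let $x_1,x_2,\dots$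 be a fixed enumeration of the variables. $\mathsf{FO}^+(0,k,d)$ is the set of all $\varphi\in\mathsf{FO}^+$ with $\mathrm{qr}(\varphi)=0$, $\mathrm{free}(\varphi)\subseteq\{x_1,\dots,x_k\}$, $\mathrm{md}(\varphi)\le d$. $\mathsf{FO}^+(q+1,k,d)$ is the set of all $\varphi$ with $\mathrm{free}(\varphi)\subseteq\{x_1,\dots,x_k\}$ that are Boolean combinations of: (i) formulas in $\mathsf{FO}^+(q,k+1,d)$ with free variables among $x_1,\dots,x_k$; (ii) $\mathrm{dist}(x_i,x_j)\le\tilde d$ with $i,j\in[k]$, $\tilde d\le\mathrm r_1(q+1,k,d)$; (iii) $\exists x_{k+1}(\mathrm{dist}(x_i,x_{k+1})\le\hat d\wedge\psi)$ with $\psi\in\mathsf{FO}^+(q,k+1,d)$, $i\in[k]$, $\hat d\le\mathrm r_1(q+1,k,d)-\mathrm r_1(q,k+1,d)$; (iv) $\exists x_{k+1}\,\psi$ with $\psi\in\mathsf{FO}^+(q,k+1,d)$. A basic local sentence for $\mathsf{FO}^+(q,k,d)$ of width $\ell$, inner distance $2r$, inner radius at most $\tilde r$, and inner quantifier rank $\mathrm{qr}(\lambda)$ is of the form $\exists y_1\cdots\exists y_\ell\big(\bigwedge_{1\le i<j\le\ell}\mathrm{dist}(y_i,y_j)>2r\wedge\bigwedge_{j\in[\ell]}\lambda(y_j)\big)$ with $\ell\ge1$, $r\ge\tilde r\ge0$, and $\lambda(x_1)\in\mathsf{FO}^+(q-1,k+1,d)$ $\tilde r$-local with no free variable other than $x_1$.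 For $q=0$ there are no basic local sentences. For a Boolean combination $\varphi'$ of local formulas (set $\mathcal L$) and basic local sentences (set $\mathcal S$): the outer quantifier rank is the maximum $\mathrm{qr}$ of formulas in $\mathcal L$; outer radius at most $r$ means every formula in $\mathcal L$ is $r$-local; inner quantifier rank, inner radius, inner distance and width are the maxima over the sentences in $\mathcal S$. Upper bounds on maxima over empty sets are vacuous. -}

module Defs where

open import Level using (Level; 0ℓ)
open import Data.Bool using (Bool; T; if_then_else_)
open import Data.Bool.Properties using (T?)
open import Data.Empty using (⊥)
open import Data.Fin using (Fin)
import Data.Fin.Properties as Fin
open import Data.Irrelevant using ([_])
open import Data.List as List using (List; []; _∷_; _++_)
open import Data.List.Extrema.Nat using (max)
open import Data.List.Membership.Propositional using (_∈_; find; lose)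
open import Data.List.Membership.Propositional.Properties using (∈-concatMap⁺)
open import Data.List.Relation.Binary.Subset.Propositional using (_⊆_)
open import Data.List.Relation.Unary.All using (All)
open import Data.List.Relation.Unary.Any as Any using (here)
open import Data.List.Relation.Unary.Unique.Propositional using (Unique)
open import Data.Nat using (ℕ; zero; suc; _*_; _∸_; _⊔_; _≤_; _<_; z≤n; s≤s; s≤s⁻¹)
open import Data.Nat.Properties using (_≟_; anyUpTo?)
open import Data.Product using (∃; ∃-syntax; Σ-syntax; _×_; _,_; proj₂; map₂)
open import Data.Refinement using (Refinement-syntax; value; _,_)
open import Data.Refinement.Properties using (value-injective)
open import Data.Sum using (_⊎_; [_,_]′)
open import Data.Unit.Polymorphic using (⊤)
open import Data.Vec as Vec using (Vec; []; _∷_; toList)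
import Data.Vec.Membership.DecPropositional as DecVecMembership
import Data.Vec.Membership.Propositional as VecMembership
import Data.Vec.Relation.Unary.Any as VecAny
open import Function using (_∘_; id; const; _⇔_)
open import Relation.Binary using (DecidableEquality)
open import Relation.Binary.PropositionalEquality using (_≡_; _≢_; refl; cong)
open import Relation.Nullary
  using (¬_; ¬?; Dec; yes; no; does; map′; _×-dec_; contradiction-irr)
open import Relation.Unary using (Pred; Decidable)

private variable
  a b p : Level
  A : Set a
  n : ℕ

record Signature : Set where
  field
    symbols : ℕ
    arity   : Fin symbols → ℕ

  Symbol : Set
  Symbol = Fin symbols

open Signature public

record Structure (σ : Signature) : Set₁ where
  infix 4 _≟ᶜ_
  field
    Carrier     : Set
    _≟ᶜ_        : DecidableEquality Carrier
    elements    : List Carrier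
    enumeration : ∀ x → x ∈ elements
    nonEmpty    : Carrier
    rel         : (R : Symbol σ) → Vec Carrier (arity σ R) → Bool

open Structure public using (Carrier; rel)

module _ {σ : Signature} (𝔸 : Structure σ) where
  open Structure 𝔸 using (_≟ᶜ_; elements; enumeration)
  private
    C : Set
    C = Carrier 𝔸

  open VecMembership using () renaming (_∈_ to _∈ᵛ_)
  open DecVecMembership _≟ᶜ_ using () renaming (_∈?_ to _∈ᵛ?_)

  -- The Gaifman graph.
  Adjacent : C → C → Set
  Adjacent x y = x ≢ y ×
    (∃[ R ] Σ[ t ∈ Vec C (arity σ R) ] (T (rel 𝔸 R t) × x ∈ᵛ t × y ∈ᵛ t))

  Walk : ℕ → C → C → Set
  Walk zero    x y = x ≡ y
  Walk (suc m) x z = ∃[ y ] (Adjacent x y × Walk m y z)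

  Dist≤ : C → C → ℕ → Set
  Dist≤ x y d = ∃[ m ] (m ≤ d × Walk m x y)

  Near : ℕ → Vec C n → C → Set
  Near r as y = VecAny.Any (λ x → Dist≤ x y r) as

  ∃? : {P : Pred C p} → Decidable P → Dec (∃ P)
  ∃? P? = map′ (map₂ proj₂ ∘ find) (λ (x , px) → lose (enumeration x) px)
               (Any.any? P? elements)

  ∃ᵛ? : {P : Pred (Vec C n) p} → Decidable P → Dec (∃ P)
  ∃ᵛ? {n = zero}  P? = map′ ([] ,_) (λ { ([] , p) → p }) (P? [])
  ∃ᵛ? {n = suc n} P? =
    map′ (λ (x , xs , p) → (x ∷ xs) , p) (λ { ((x ∷ xs) , p) → x , xs , p })
         (∃? λ x → ∃ᵛ? λ xs → P? (x ∷ xs))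

  adjacent? : ∀ x y → Dec (Adjacent x y)
  adjacent? x y = ¬? (x ≟ᶜ y) ×-dec
    Fin.any? λ R → ∃ᵛ? λ t → T? (rel 𝔸 R t) ×-dec (x ∈ᵛ? t) ×-dec (y ∈ᵛ? t)

  walk? : ∀ m x y → Dec (Walk m x y)
  walk? zero    x y = x ≟ᶜ y
  walk? (suc m) x z = ∃? λ y → adjacent? x y ×-dec walk? m y z

  dist≤? : ∀ x y d → Dec (Dist≤ x y d)
  dist≤? x y d = map′ (λ (m , m<1+d , w) → m , s≤s⁻¹ m<1+d , w)
                      (λ (m , m≤d , w) → m , s≤s m≤d , w)
                      (anyUpTo? (λ m → walk? m x y) (suc d))

  near? : ∀ r (as : Vec C n) y → Dec (Near r as y)
  near? r as y = VecAny.any? (λ x → dist≤? x y r) as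

  -- Membership in the subset is proof-irrelevant, so that elements of the
  -- substructure are equal as soon as their underlying elements are.
  induced : {P : Pred C 0ℓ} → Decidable P → ∃ P → Structure σ
  induced {P} P? (c , pc) = record
    { Carrier     = [ x ∈ C ∣ P x ]
    ; _≟ᶜ_        = λ x y → map′ value-injective (cong value) (value x ≟ᶜ value y)
    ; elements    = List.concatMap restrict elements
    ; enumeration = λ x →
        ∈-concatMap⁺ restrict (lose (enumeration (value x)) (∈-restrict x))
    ; nonEmpty    = c , [ pc ]
    ; rel         = λ R t → rel 𝔸 R (Vec.map value t)
    }
    where
    restrict : C → List [ x ∈ C ∣ P x ]
    restrict x with P? x
    ... | yes px = (x , [ px ]) ∷ []
    ... | no  _  = []

    ∈-restrict : ∀ x → x ∈ restrict (value x)
    ∈-restrict (x , [ px ]) with P? x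
    ... | yes _  = here refl
    ... | no ¬px = contradiction-irr px ¬px

  near-head : ∀ r (as : Vec C (suc n)) → Near r as (Vec.head as)
  near-head r (_ ∷ _) = VecAny.here (0 , z≤n , refl)

  Neighbourhood : ℕ → Vec C (suc n) → Structure σ
  Neighbourhood r as = induced (near? r as) (Vec.head as , near-head r as)

-- The variable x₁ is 0, x₂ is 1, and so on: {x₁,…,xₖ} is {v | v < k}, and
-- xₖ₊₁ is k.
Var : Set
Var = ℕ

x₁ : Var
x₁ = 0

infixl 9 _[_↦_]

_[_↦_] : (Var → A) → Var → A → Var → A
(f [ x ↦ a ]) y = if does (y ≟ x) then a else f y

infix  7 _≐_
infixr 6 _∧_
infixr 5 _∨_

data Formula (σ : Signature) : Set where
  true false : Formula σ
  _≐_        : Var → Var → Formula σ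
  atom       : (R : Symbol σ) → Vec Var (arity σ R) → Formula σ
  dist≤      : Var → Var → ℕ → Formula σ
  not        : Formula σ → Formula σ
  _∧_ _∨_    : Formula σ → Formula σ → Formula σ
  ex         : Var → Formula σ → Formula σ

private variable
  σ : Signature

dist> : Var → Var → ℕ → Formula σ
dist> x y r = not (dist≤ x y r)

⋀ : List (Formula σ) → Formula σ
⋀ = List.foldr _∧_ true

ex* : List Var → Formula σ → Formula σ
ex* xs φ = List.foldr ex φ xs

free : Formula σ → List Var
free true          = []
free false         = []
free (x ≐ y)       = x ∷ y ∷ []
free (atom R xs)   = toList xs
free (dist≤ x y d) = x ∷ y ∷ []
free (not φ)       = free φ
free (φ ∧ ψ)       = free φ ++ free ψ
free (φ ∨ ψ)       = free φ ++ free ψ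
free (ex x φ)      = List.filter (λ y → ¬? (y ≟ x)) (free φ)

qr : Formula σ → ℕ
qr true          = 0
qr false         = 0
qr (x ≐ y)       = 0
qr (atom R xs)   = 0
qr (dist≤ x y d) = 0
qr (not φ)       = qr φ
qr (φ ∧ ψ)       = qr φ ⊔ qr ψ
qr (φ ∨ ψ)       = qr φ ⊔ qr ψ
qr (ex x φ)      = suc (qr φ)

md : Formula σ → ℕ
md true          = 0
md false         = 0
md (x ≐ y)       = 0
md (atom R xs)   = 0
md (dist≤ x y d) = d
md (not φ)       = md φ
md (φ ∧ ψ)       = md φ ⊔ md ψ
md (φ ∨ ψ)       = md φ ⊔ md ψ
md (ex x φ)      = md φ

-- Capture-avoiding: every bound variable is replaced by one larger than all
-- variables substituted for the free variables in its scope.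
rename : (Var → Var) → Formula σ → Formula σ
rename ρ true          = true
rename ρ false         = false
rename ρ (x ≐ y)       = ρ x ≐ ρ y
rename ρ (atom R xs)   = atom R (Vec.map ρ xs)
rename ρ (dist≤ x y d) = dist≤ (ρ x) (ρ y) d
rename ρ (not φ)       = not (rename ρ φ)
rename ρ (φ ∧ ψ)       = rename ρ φ ∧ rename ρ ψ
rename ρ (φ ∨ ψ)       = rename ρ φ ∨ rename ρ ψ
rename ρ (ex x φ)      = ex z (rename (ρ [ x ↦ z ]) φ)
  where z = suc (max 0 (List.map ρ (free (ex x φ))))

infix 3 _,_⊨_

_,_⊨_ : (𝔸 : Structure σ) → (Var → Carrier 𝔸) → Formula σ → Set
𝔸 , α ⊨ true        = ⊤
𝔸 , α ⊨ false       = ⊥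
𝔸 , α ⊨ x ≐ y       = α x ≡ α y
𝔸 , α ⊨ atom R xs   = T (rel 𝔸 R (Vec.map α xs))
𝔸 , α ⊨ dist≤ x y d = Dist≤ 𝔸 (α x) (α y) d
𝔸 , α ⊨ not φ       = ¬ (𝔸 , α ⊨ φ)
𝔸 , α ⊨ φ ∧ ψ       = (𝔸 , α ⊨ φ) × (𝔸 , α ⊨ ψ)
𝔸 , α ⊨ φ ∨ ψ       = (𝔸 , α ⊨ φ) ⊎ (𝔸 , α ⊨ ψ)
𝔸 , α ⊨ ex x φ      = ∃[ a ] (𝔸 , α [ x ↦ a ] ⊨ φ)

infix 4 _≣_

_≣_ : Formula σ → Formula σ → Set₁
_≣_ {σ} φ ψ = (𝔸 : Structure σ) (α : Var → Carrier 𝔸) → (𝔸 , α ⊨ φ) ⇔ (𝔸 , α ⊨ ψ)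

-- Assignments are total, so φ(ā) is evaluated under any assignments α to 𝔸
-- and β to the neighbourhood that interpret x̄ by ā; their values outside x̄
-- are irrelevant since x̄ contains all free variables.
IsLocal : ℕ → Formula σ → Set₁
IsLocal {σ} r φ =
  ∃[ n ] Σ[ x̄ ∈ Vec Var (suc n) ] (free φ ⊆ toList x̄ ×
    ((𝔸 : Structure σ) (ā : Vec (Carrier 𝔸) (suc n)) →
     (α : Var → Carrier 𝔸) (β : Var → Carrier (Neighbourhood 𝔸 r ā)) →
     Vec.map α x̄ ≡ ā → Vec.map (value ∘ β) x̄ ≡ ā →
     (𝔸 , α ⊨ φ) ⇔ (Neighbourhood 𝔸 r ā , β ⊨ φ)))

Local : Formula σ → Set₁
Local φ = ∃[ r ] IsLocal r φ

data BooleanCombination {σ} (P : Formula σ → Set p) : Formula σ → Set p where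
  leaf : ∀ {φ}   → P φ → BooleanCombination P φ
  not  : ∀ {φ}   → BooleanCombination P φ → BooleanCombination P (not φ)
  _∧_  : ∀ {φ ψ} → BooleanCombination P φ → BooleanCombination P ψ →
         BooleanCombination P (φ ∧ ψ)
  _∨_  : ∀ {φ ψ} → BooleanCombination P φ → BooleanCombination P ψ →
         BooleanCombination P (φ ∨ ψ)

AllLeaves : {P : Formula σ → Set p} → (∀ {χ} → P χ → Set b) →
            ∀ {φ} → BooleanCombination P φ → Set b
AllLeaves Q (leaf l) = Q l
AllLeaves Q (not c)  = AllLeaves Q c
AllLeaves Q (c ∧ c′) = AllLeaves Q c × AllLeaves Q c′
AllLeaves Q (c ∨ c′) = AllLeaves Q c × AllLeaves Q c′

r₁ : ℕ → ℕ → ℕ → ℕ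
r₁ zero    k d = d ⊔ 1
r₁ (suc q) k d = 4 * k * r₁ q (suc k) d

FreeIn : ℕ → Formula σ → Set
FreeIn k φ = All (_< k) (free φ)

-- Prev is FO⁺(q,k+1,d), R is r₁(q+1,k,d) and R′ is r₁(q,k+1,d).
data Generator {σ} (Prev : Formula σ → Set) (k R R′ : ℕ) : Formula σ → Set where
  lower  : ∀ {φ} → Prev φ → FreeIn k φ → Generator Prev k R R′ φ
  dist   : ∀ {i j d̃} → i < k → j < k → d̃ ≤ R → Generator Prev k R R′ (dist≤ i j d̃)
  exNear : ∀ {i d̂ ψ} → i < k → d̂ ≤ R ∸ R′ → Prev ψ →
           Generator Prev k R R′ (ex k (dist≤ i k d̂ ∧ ψ))
  exAny  : ∀ {ψ} → Prev ψ → Generator Prev k R R′ (ex k ψ)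

FO⁺ : (q k d : ℕ) → Formula σ → Set
FO⁺ zero    k d φ = qr φ ≡ 0 × FreeIn k φ × md φ ≤ d
FO⁺ (suc q) k d φ = FreeIn k φ ×
  BooleanCombination (Generator (FO⁺ q (suc k) d) k (r₁ (suc q) k d) (r₁ q (suc k) d)) φ

pairs : List A → List (A × A)
pairs []       = []
pairs (x ∷ xs) = List.map (x ,_) xs ++ pairs xs

scattered : List Var → ℕ → Formula σ → Formula σ
scattered ys r λ₁ = ex* ys
  (⋀ (List.map (λ (y , y′) → dist> y y′ (2 * r)) (pairs ys)) ∧
   ⋀ (List.map (λ y → rename (id [ x₁ ↦ y ]) λ₁) ys))

record BasicLocalSentence {σ} (q k d : ℕ) (χ : Formula σ) : Set₁ where
  field
    q>0       : 0 < q
    ys        : List Var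
    ys-unique : Unique ys
    r r̃       : ℕ
    λ₁        : Formula σ
    r̃≤r       : r̃ ≤ r
    ℓ≥1       : 1 ≤ List.length ys
    λ₁∈FO⁺    : FO⁺ (q ∸ 1) (suc k) d λ₁
    λ₁-free   : free λ₁ ⊆ x₁ ∷ []
    λ₁-local  : IsLocal r̃ λ₁
    shape     : χ ≡ scattered ys r λ₁

  width innerDistance innerRank : ℕ
  width         = List.length ys
  innerDistance = 2 * r
  innerRank     = qr λ₁

  innerRadius : ℕ
  innerRadius = r̃

LocalIn : (q k d : ℕ) → Formula σ → Set₁
LocalIn q k d χ = FO⁺ q k d χ × Local χ

GaifmanNormalForm : (q k d : ℕ) → Formula σ → Set₁
GaifmanNormalForm q k d =
  BooleanCombination (λ χ → LocalIn q k d χ ⊎ BasicLocalSentence q k d χ)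

module _ {σ : Signature} {q k d : ℕ} where

  AllLocal : (Formula σ → Set b) → ∀ {φ} → GaifmanNormalForm q k d φ → Set b
  AllLocal Q = AllLeaves λ {χ} → [ const (Q χ) , const ⊤ ]′

  AllSentences : (∀ {χ : Formula σ} → BasicLocalSentence q k d χ → Set b) →
                 ∀ {φ} → GaifmanNormalForm q k d φ → Set b
  AllSentences Q = AllLeaves [ const ⊤ , Q ]′

  module _ {φ : Formula σ} (N : GaifmanNormalForm q k d φ) where
    open BasicLocalSentence

    OuterRank≤ : ℕ → Set
    OuterRank≤ m = AllLocal (λ χ → qr χ ≤ m) N

    OuterRadius≤ : ℕ → Set₁
    OuterRadius≤ m = AllLocal (IsLocal m) N

    -- "At most m − 1", which for m = 0 excludes all basic local sentences.
    InnerRank< : ℕ → Set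
    InnerRank< m = AllSentences (λ s → innerRank s < m) N

    InnerRadius≤ : ℕ → Set
    InnerRadius≤ m = AllSentences (λ s → innerRadius s ≤ m) N

    InnerDistance≤ : ℕ → Set
    InnerDistance≤ m = AllSentences (λ s → innerDistance s ≤ m) N

    Width≤ : ℕ → Set
    Width≤ m = AllSentences (λ s → width s ≤ m) N

{-# OPTIONS --safe #-}
module Submission where

-- Only unbounded quantifiers ∃xₖ₊₁ ψ are not already local.  By induction ψ is
-- a Boolean combination of sentences and of a formula L that is R′-local, where
-- R′ = r₁(q,k+1,d); let R = r₁(q+1,k,d) = 4kR′.  A witness of L within R − R′
-- of some xᵢ is found by a local formula.  When the witness has distance more
-- than R′ from all xᵢ, L splits into a statement about x̄ and a statement β about
-- the witness alone, and it remains to tell apart "β holds at some point further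
-- than R − R′ from x̄" from "β holds only within R′ of x̄".  Let c(s) be the
-- largest number of xᵢ that are pairwise further apart than s and have a β-point
-- within R′.  As c decreases from at most k, there is some t with t = k or
-- c(4(t+1)R′) ≥ k − t, and c(4tR′) ≤ k − t.  In the first situation k − t + 1
-- many β-points have pairwise distance greater than (4t+2)R′: the far one, and
-- one near each of k − t many xᵢ.  In the second situation there cannot be so
-- many, because the xᵢ near them would be further apart than 4tR′.

open import Defs
open import Data.Bool using (T; if_then_else_)
open import Data.Bool.Properties using (T?)
open import Data.Fin as Fin using (Fin; toℕ; fromℕ<)
import Data.Fin.Properties as Fin
open import Data.Irrelevant using ([_])
open import Data.List as List
  using (List; []; _∷_; _++_; map; length; upTo; applyUpTo; concatMap; cartesianProductWith)
open import Data.List.Extrema.Nat using (max; xs≤max)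
open import Data.List.Membership.Propositional using (_∈_; _∉_; find; lose)
open import Data.List.Membership.Propositional.Properties
  using (∈-++⁺ˡ; ∈-++⁺ʳ; ∈-++⁻; ∈-filter⁺; ∈-filter⁻; ∈-map⁺; ∈-map⁻; ∈-lookup; ∈-upTo⁺;
         ∈-cartesianProductWith⁺; ∈-cartesianProductWith⁻)
import Data.List.Properties as List
open import Data.List.Relation.Binary.BagAndSetEquality using (_∼[_]_; set)
open import Data.List.Relation.Binary.Pointwise using (Pointwise; []; _∷_; Pointwise-length)
open import Data.List.Relation.Binary.Subset.Propositional using (_⊆_)
open import Data.List.Relation.Unary.All as All using (All; []; _∷_)
import Data.List.Relation.Unary.All.Properties as All
open import Data.List.Relation.Unary.AllPairs as AllPairs using (AllPairs; []; _∷_)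
import Data.List.Relation.Unary.AllPairs.Properties as AllPairs
open import Data.List.Relation.Unary.Any as Any using (Any; here; there)
import Data.List.Relation.Unary.Any.Properties as Any
open import Data.List.Relation.Unary.Unique.Propositional.Properties using (upTo⁺)
open import Data.Nat
  using (ℕ; zero; suc; _+_; _*_; _∸_; _⊔_; _≤_; _<_; z≤n; s≤s; s≤s⁻¹)
open import Data.Nat.Properties as ℕ using (_≟_)
open import Data.Nat.Solver using (module +-*-Solver)
open import Data.Product as Product
  using (∃; ∃-syntax; Σ-syntax; _×_; _,_; proj₁; proj₂; uncurry; curry)
open import Data.Product.Function.NonDependent.Propositional using (_×-⇔_)
open import Data.Refinement using (value; _,_)
open import Data.Refinement.Properties using (value-injective)
open import Data.Sum as Sum using (_⊎_; inj₁; inj₂)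
open import Data.Sum.Function.Propositional using (_⊎-⇔_)
open import Data.Unit.Polymorphic using (tt)
open import Data.Vec as Vec using (Vec; []; _∷_; toList)
open import Data.Vec.Membership.Propositional using () renaming (_∈_ to _∈ᵛ_)
import Data.Vec.Membership.Propositional.Properties as VecMembership
import Data.Vec.Properties as Vec
open import Data.Vec.Relation.Unary.Any as VecAny using (here; there)
import Data.Vec.Relation.Unary.Any.Properties as VecAny
open import Function using (_∘_; id; const; _⇔_; mk⇔; Equivalence)
open import Function.Construct.Composition using (_⇔-∘_)
open import Function.Construct.Identity using (⇔-id)
open import Function.Construct.Symmetry using (⇔-sym)
open import Function.Related.TypeIsomorphisms using (¬-cong-⇔)
open import Relation.Binary.PropositionalEquality
  using (_≡_; _≢_; refl; sym; trans; cong; cong₂; subst)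
open import Relation.Nullary
  using (¬_; ¬?; Dec; yes; no; map′; _×-dec_; _⊎-dec_; contradiction)
open import Relation.Nullary.Decidable using (dec-true; dec-false)

open Equivalence using (to; from)

private variable
  A B : Set
  σ : Signature
  d q k m m′ n : ℕ
  x y : Var
  W X Y Z : List Var

-- The far cases need not pin down one exact radius. It is enough that they hold when `β` has a
-- point beyond `R − R′` and that they imply one beyond `R′`: witnesses in between are caught by the
-- near cases, and overlap is harmless. This fixes the constant in `R = 4kR′`. Exchanging two `xᵢ`
-- for `β`-points near them, or conversely, costs `2R′`, so the thresholds advance by `4R′` and
-- `(4t+2)R′` lies halfway between two of them. At most `k` steps are made, and a point beyond
-- `R − R′` from `x̄` is further than `(4(k−1)+2)R′` from every `β`-point within `R′` of `x̄`. That
-- is exactly what the largest `t < k` asks for, while `t = k` asks for a single point only. The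
-- induction maintains disjunctions of pairs of a sentence and a bounded formula. An existential
-- quantifier distributes over the disjunction and passes the closed sentence, so only one bounded
-- formula has to be treated at a time.

∃-⇔ : ∀ {p q} {P : A → Set p} {Q : A → Set q} → (∀ a → P a ⇔ Q a) → ∃ P ⇔ ∃ Q
∃-⇔ f = mk⇔ (λ (a , p) → a , to (f a) p) (λ (a , q) → a , from (f a) q)

update-same : ∀ (f : Var → A) x {a} → (f [ x ↦ a ]) x ≡ a
update-same f x {a} = cong (λ b → if b then a else f x) (dec-true (x ≟ x) refl)

update-other : ∀ (f : Var → A) {x y a} → y ≢ x → (f [ x ↦ a ]) y ≡ f y
update-other f {x} {y} {a} y≢x = cong (λ b → if b then a else f y) (dec-false (y ≟ x) y≢x)

-- Gaifman distance and satisfaction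

module _ (𝔸 : Structure σ) where

  private variable
    a b c : Carrier 𝔸
    r s   : ℕ

  dist-refl : Dist≤ 𝔸 a a 0
  dist-refl = 0 , z≤n , refl

  dist-mono : r ≤ s → Dist≤ 𝔸 a b r → Dist≤ 𝔸 a b s
  dist-mono r≤s (m , m≤r , w) = m , ℕ.≤-trans m≤r r≤s , w

  walk-++ : ∀ m → Walk 𝔸 m a b → Walk 𝔸 n b c → Walk 𝔸 (m + n) a c
  walk-++ zero    refl         w′ = w′
  walk-++ (suc m) (_ , e , w) w′ = _ , e , walk-++ m w w′

  dist-trans : Dist≤ 𝔸 a b r → Dist≤ 𝔸 b c s → Dist≤ 𝔸 a c (r + s)
  dist-trans (m , m≤r , w) (n , n≤s , w′) = m + n , ℕ.+-mono-≤ m≤r n≤s , walk-++ m w w′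

  adjacent-sym : Adjacent 𝔸 a b → Adjacent 𝔸 b a
  adjacent-sym (a≢b , R , t , Rt , a∈t , b∈t) = a≢b ∘ sym , R , t , Rt , b∈t , a∈t

  walk-sym : ∀ m → Walk 𝔸 m a b → Walk 𝔸 m b a
  walk-sym zero    refl = refl
  walk-sym {a} {b} (suc m) (_ , e , w) =
    subst (λ n → Walk 𝔸 n b a) (ℕ.+-comm m 1)
      (walk-++ m (walk-sym m w) (_ , adjacent-sym e , refl))

  dist-sym : Dist≤ 𝔸 a b r → Dist≤ 𝔸 b a r
  dist-sym (m , m≤r , w) = m , m≤r , walk-sym m w

  dist-tuple : ∀ R {t} → T (rel 𝔸 R t) → a ∈ᵛ t → b ∈ᵛ t → Dist≤ 𝔸 a b 1
  dist-tuple {a} {b} R Rt a∈t b∈t with Structure._≟ᶜ_ 𝔸 a b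
  ... | yes refl = dist-mono z≤n dist-refl
  ... | no a≢b   = 1 , ℕ.≤-refl , b , (a≢b , R , _ , Rt , a∈t , b∈t) , refl

  -- Universes are finite, so satisfaction is decidable. This supplies constructively the case
  -- distinctions behind the negation of mixes, the encoded disjunction and the search for a
  -- threshold.
  sat? : ∀ α φ → Dec (𝔸 , α ⊨ φ)
  sat? α true          = yes tt
  sat? α false         = no λ ()
  sat? α (x ≐ y)       = Structure._≟ᶜ_ 𝔸 (α x) (α y)
  sat? α (atom R xs)   = T? _
  sat? α (dist≤ x y d) = dist≤? 𝔸 (α x) (α y) d
  sat? α (not φ)       = ¬? (sat? α φ)
  sat? α (φ ∧ ψ)       = sat? α φ ×-dec sat? α ψ
  sat? α (φ ∨ ψ)       = sat? α φ ⊎-dec sat? α ψ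
  sat? α (ex x φ)      = ∃? 𝔸 λ a → sat? (α [ x ↦ a ]) φ

  Agree : List Var → (α β : Var → Carrier 𝔸) → Set
  Agree X α β = ∀ {x} → x ∈ X → α x ≡ β x

  map-agree : ∀ {α β : Var → Carrier 𝔸} (xs : Vec Var n) → Agree (toList xs) α β →
              Vec.map α xs ≡ Vec.map β xs
  map-agree []       eq = refl
  map-agree (x ∷ xs) eq = cong₂ _∷_ (eq (here refl)) (map-agree xs (eq ∘ there))

  free-ex : ∀ {x y} (φ : Formula σ) → y ∈ free φ → y ≢ x → y ∈ free (ex x φ)
  free-ex {x} φ y∈φ y≢x = ∈-filter⁺ (λ y → ¬? (y ≟ x)) y∈φ y≢x

  coincidence : ∀ φ {α β} → Agree (free φ) α β → (𝔸 , α ⊨ φ) ⇔ (𝔸 , β ⊨ φ)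
  coincidence true          eq = ⇔-id _
  coincidence false         eq = ⇔-id _
  coincidence (x ≐ y)       eq
    rewrite eq (here refl) | eq (there (here refl)) = ⇔-id _
  coincidence (atom R xs)   eq rewrite map-agree xs eq = ⇔-id _
  coincidence (dist≤ x y d) eq
    rewrite eq (here refl) | eq (there (here refl)) = ⇔-id _
  coincidence (not φ)       eq = ¬-cong-⇔ (coincidence φ eq)
  coincidence (φ ∧ ψ)       eq =
    coincidence φ (eq ∘ ∈-++⁺ˡ) ×-⇔ coincidence ψ (eq ∘ ∈-++⁺ʳ (free φ))
  coincidence (φ ∨ ψ)       eq =
    coincidence φ (eq ∘ ∈-++⁺ˡ) ⊎-⇔ coincidence ψ (eq ∘ ∈-++⁺ʳ (free φ))
  coincidence (ex x φ) {α} {β} eq = ∃-⇔ λ a → coincidence φ (eq′ a)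
    where
    eq′ : ∀ a → Agree (free φ) (α [ x ↦ a ]) (β [ x ↦ a ])
    eq′ a {y} y∈φ with y ≟ x
    ... | yes refl = trans (update-same α x) (sym (update-same β x))
    ... | no y≢x   =
      trans (update-other α y≢x) (trans (eq (free-ex φ y∈φ y≢x)) (sym (update-other β y≢x)))

  rename-sat : ∀ φ {ρ α} → (𝔸 , α ⊨ rename ρ φ) ⇔ (𝔸 , α ∘ ρ ⊨ φ)
  rename-sat true          = ⇔-id _
  rename-sat false         = ⇔-id _
  rename-sat (x ≐ y)       = ⇔-id _
  rename-sat (atom R xs) {ρ} {α} rewrite Vec.map-∘ α ρ xs = ⇔-id _
  rename-sat (dist≤ x y d) = ⇔-id _
  rename-sat (not φ)       = ¬-cong-⇔ (rename-sat φ)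
  rename-sat (φ ∧ ψ)       = rename-sat φ ×-⇔ rename-sat ψ
  rename-sat (φ ∨ ψ)       = rename-sat φ ⊎-⇔ rename-sat ψ
  rename-sat (ex x φ) {ρ} {α} = ∃-⇔ λ a → coincidence φ (eq a) ⇔-∘ rename-sat φ
    where
    fresh = suc (max 0 (map ρ (free (ex x φ))))
    eq : ∀ a → Agree (free φ) ((α [ fresh ↦ a ]) ∘ (ρ [ x ↦ fresh ])) ((α ∘ ρ) [ x ↦ a ])
    eq a {y} y∈φ with y ≟ x
    ... | yes refl rewrite update-same ρ x {fresh} =
      trans (update-same α fresh) (sym (update-same (α ∘ ρ) x))
    ... | no y≢x rewrite update-other ρ {a = fresh} y≢x =
      trans (update-other α (ℕ.<⇒≢ (s≤s (All.lookup (xs≤max 0 _) (∈-map⁺ ρ (free-ex φ y∈φ y≢x))))))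
            (sym (update-other (α ∘ ρ) y≢x))

toList-map : ∀ {B : Set} (f : A → B) (xs : Vec A n) → toList (Vec.map f xs) ≡ map f (toList xs)
toList-map f []       = refl
toList-map f (x ∷ xs) = cong (f x ∷_) (toList-map f xs)

rename-free : ∀ (φ : Formula σ) {ρ y} → y ∈ free (rename ρ φ) → ∃[ x ] (x ∈ free φ × y ≡ ρ x)
rename-free (x ≐ y)       (here eq)         = x , here refl , eq
rename-free (x ≐ y)       (there (here eq)) = y , there (here refl) , eq
rename-free (atom R xs) {ρ} y∈ = ∈-map⁻ ρ (subst (_ ∈_) (toList-map ρ xs) y∈)
rename-free (dist≤ x y d) (here eq)         = x , here refl , eq
rename-free (dist≤ x y d) (there (here eq)) = y , there (here refl) , eq
rename-free (not φ)       y∈ = rename-free φ y∈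
rename-free (φ ∧ ψ) {ρ}   y∈ with ∈-++⁻ (free (rename ρ φ)) y∈
... | inj₁ y∈φ = let x , x∈ , eq = rename-free φ y∈φ in x , ∈-++⁺ˡ x∈ , eq
... | inj₂ y∈ψ = let x , x∈ , eq = rename-free ψ y∈ψ in x , ∈-++⁺ʳ (free φ) x∈ , eq
rename-free (φ ∨ ψ) {ρ}   y∈ with ∈-++⁻ (free (rename ρ φ)) y∈
... | inj₁ y∈φ = let x , x∈ , eq = rename-free φ y∈φ in x , ∈-++⁺ˡ x∈ , eq
... | inj₂ y∈ψ = let x , x∈ , eq = rename-free ψ y∈ψ in x , ∈-++⁺ʳ (free φ) x∈ , eq
rename-free (ex v φ) {ρ} {y} y∈
  with ∈-filter⁻ (λ y → ¬? (y ≟ suc (max 0 (map ρ (free (ex v φ))))))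
         {xs = free (rename (ρ [ v ↦ _ ]) φ)} y∈
... | y∈φ , y≢fresh with rename-free φ y∈φ
... | x , x∈φ , eq with x ≟ v
... | yes refl = contradiction (trans eq (update-same ρ x)) y≢fresh
... | no x≢v   = x , ∈-filter⁺ (λ y → ¬? (y ≟ v)) x∈φ x≢v , trans eq (update-other ρ x≢v)

-- Embeddings and locality

-- Locality needs of a neighbourhood only that it is an induced substructure; an abstract embedding
-- hides the membership proofs in its carrier.
record Embedding (𝔹 𝔸 : Structure σ) : Set where
  field
    fun       : Carrier 𝔹 → Carrier 𝔸
    injective : ∀ {x y} → fun x ≡ fun y → x ≡ y
    preserves : ∀ R t → rel 𝔹 R t ≡ rel 𝔸 R (Vec.map fun t)

  Image : Carrier 𝔸 → Set
  Image a = ∃[ b ] fun b ≡ a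

module _ {𝔸 𝔹 : Structure σ} (e : Embedding 𝔹 𝔸) where
  open Embedding e

  private
    ∈-map-fun⁻ : ∀ {x} (t : Vec (Carrier 𝔹) n) → fun x ∈ᵛ Vec.map fun t → x ∈ᵛ t
    ∈-map-fun⁻ (_ ∷ t) (here eq)  = here (injective eq)
    ∈-map-fun⁻ (_ ∷ t) (there x∈) = there (∈-map-fun⁻ t x∈)

  walk-image : ∀ m {x y} → Walk 𝔹 m x y → Walk 𝔸 m (fun x) (fun y)
  walk-image zero    refl = refl
  walk-image (suc m) (_ , (x≢y , R , t , Rt , x∈t , y∈t) , w) =
    _ , (x≢y ∘ injective , R , Vec.map fun t , subst T (preserves R t) Rt ,
         VecMembership.∈-map⁺ fun x∈t , VecMembership.∈-map⁺ fun y∈t) , walk-image m w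

  tuple-preimage : (t : Vec (Carrier 𝔸) n) → (∀ {a} → a ∈ᵛ t → Image a) →
                   ∃[ t′ ] Vec.map fun t′ ≡ t
  tuple-preimage []      im = [] , refl
  tuple-preimage (a ∷ t) im with im (here refl) | tuple-preimage t (im ∘ there)
  ... | b , refl | t′ , refl = b ∷ t′ , refl

  -- A substructure loses only tuples that leave it. The tuple behind the first edge lies within
  -- distance 1 of the start, and the rest of the walk starts one step further with one step less to
  -- go, so covering the ball of radius `m` is enough.
  walk-preimage : ∀ m {x y} → (∀ {a} → Dist≤ 𝔸 (fun x) a m → Image a) →
                  Walk 𝔸 m (fun x) (fun y) → Walk 𝔹 m x y
  walk-preimage zero    im eq = injective eq
  walk-preimage (suc m) im (z , adj@(x≢z , R , t , Rt , x∈t , z∈t) , w)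
    with tuple-preimage t (λ a∈t → im (dist-mono 𝔸 (s≤s z≤n) (dist-tuple 𝔸 R Rt x∈t a∈t)))
       | im (dist-mono 𝔸 (s≤s z≤n) (dist-tuple 𝔸 R Rt x∈t z∈t))
  ... | t′ , refl | z′ , refl =
    z′ , ((λ { refl → x≢z refl }) , R , t′ , subst T (sym (preserves R t′)) Rt ,
          ∈-map-fun⁻ t′ x∈t , ∈-map-fun⁻ t′ z∈t) ,
    walk-preimage m (im ∘ dist-trans 𝔸 (1 , ℕ.≤-refl , z , adj , refl)) w

  dist-embedding : ∀ {r x y} → (∀ {a} → Dist≤ 𝔸 (fun x) a r → Image a) →
                   Dist≤ 𝔸 (fun x) (fun y) r ⇔ Dist≤ 𝔹 x y r
  dist-embedding im = mk⇔
    (λ (m , m≤r , w) → m , m≤r , walk-preimage m (im ∘ dist-mono 𝔸 m≤r) w)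
    (λ (m , m≤r , w) → m , m≤r , walk-image m w)

-- Radii and bounded formulas

r₁-pos : ∀ q → 0 < k → 1 ≤ r₁ q k d
r₁-pos {k} {d} zero    _ = ℕ.m≤n⊔m d 1
r₁-pos {suc k} (suc q) _ = ℕ.*-mono-≤ {1} {4 * suc k} (s≤s z≤n) (r₁-pos q (s≤s z≤n))

r₁-step : ∀ q → 0 < k → r₁ q (suc k) d ≤ r₁ (suc q) k d
r₁-step {suc k} q _ = ℕ.m≤n*m _ (4 * suc k)

near-radius : ∀ q → 0 < k → n ≤ r₁ (suc q) k d ∸ r₁ q (suc k) d →
              n + r₁ q (suc k) d ≤ r₁ (suc q) k d
near-radius {n = n} q 0<k n≤ = ℕ.m≤o∸n⇒m+n≤o n (r₁-step q 0<k) n≤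

-- At `q = 0` distance atoms are bounded by `d`, although the radius is `d ⊔ 1`; the 1 is there for
-- relational atoms, whose tuples have diameter at most 1.
distBound : (q k d : ℕ) → ℕ
distBound zero    k d = d
distBound (suc q) k d = r₁ (suc q) k d

distBound≤r₁ : ∀ q → distBound q k d ≤ r₁ q k d
distBound≤r₁ {d = d} zero = ℕ.m≤m⊔n d 1
distBound≤r₁ (suc q)      = ℕ.≤-refl

-- The formulas in FO⁺(q,k,d) built without the unbounded quantifier (iv), of
-- quantifier rank at most m and with free variables in X.
data Bounded (σ : Signature) (d : ℕ) : (q k m : ℕ) → List Var → Set where
  true  : Bounded σ d q k m X
  equal : x ∈ X → y ∈ X → Bounded σ d q k m X
  atom  : (R : Symbol σ) (xs : Vec Var (arity σ R)) → toList xs ⊆ X → Bounded σ d q k m X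
  dist  : x ∈ X → y ∈ X → n ≤ distBound q k d → Bounded σ d q k m X
  not   : Bounded σ d q k m X → Bounded σ d q k m X
  _∧_   : Bounded σ d q k m X → Bounded σ d q k m X → Bounded σ d q k m X
  lower : m ≤ m′ → Bounded σ d q (suc k) m X → Bounded σ d (suc q) k m′ X
  near  : x ∈ X → n ≤ r₁ (suc q) k d ∸ r₁ q (suc k) d → Y ⊆ k ∷ X →
          Bounded σ d q (suc k) m Y → Bounded σ d (suc q) k (suc m) X

⟦_⟧ : Bounded σ d q k m X → Formula σ
⟦ true ⟧                              = true
⟦ equal {x = x} {y = y} _ _ ⟧         = x ≐ y
⟦ atom R xs _ ⟧                       = atom R xs
⟦ dist {x = x} {y = y} {n = n} _ _ _ ⟧ = dist≤ x y n
⟦ not l ⟧                             = not ⟦ l ⟧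
⟦ l ∧ l′ ⟧                            = ⟦ l ⟧ ∧ ⟦ l′ ⟧
⟦ lower _ l ⟧                         = ⟦ l ⟧
⟦ near {x = x} {n = n} {k = k} _ _ _ l ⟧ = ex k (dist≤ x k n ∧ ⟦ l ⟧)

⟦⟧-qr : (l : Bounded σ d q k m X) → qr ⟦ l ⟧ ≤ m
⟦⟧-qr true           = z≤n
⟦⟧-qr (equal _ _)    = z≤n
⟦⟧-qr (atom _ _ _)   = z≤n
⟦⟧-qr (dist _ _ _)   = z≤n
⟦⟧-qr (not l)        = ⟦⟧-qr l
⟦⟧-qr (l ∧ l′)       = ℕ.⊔-lub (⟦⟧-qr l) (⟦⟧-qr l′)
⟦⟧-qr (lower m≤ l)   = ℕ.≤-trans (⟦⟧-qr l) m≤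
⟦⟧-qr (near _ _ _ l) = s≤s (⟦⟧-qr l)

∈-∷-≢ : x ∈ y ∷ X → x ≢ y → x ∈ X
∈-∷-≢ (here x≡y)  x≢y = contradiction x≡y x≢y
∈-∷-≢ (there x∈X) _   = x∈X

⟦⟧-free : (l : Bounded σ d q k m X) → free ⟦ l ⟧ ⊆ X
⟦⟧-free (equal x∈ y∈)  (here refl)         = x∈
⟦⟧-free (equal x∈ y∈)  (there (here refl)) = y∈
⟦⟧-free (atom _ _ ⊆X)  x∈                  = ⊆X x∈
⟦⟧-free (dist x∈ y∈ _) (here refl)         = x∈
⟦⟧-free (dist x∈ y∈ _) (there (here refl)) = y∈
⟦⟧-free (not l)        x∈                  = ⟦⟧-free l x∈
⟦⟧-free (l ∧ l′)       x∈                  = Sum.[ ⟦⟧-free l , ⟦⟧-free l′ ]′ (∈-++⁻ (free ⟦ l ⟧) x∈)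
⟦⟧-free (lower _ l)    x∈                  = ⟦⟧-free l x∈
⟦⟧-free (near {x = x} {k = k} x∈ _ Y⊆ l) z∈
  with ∈-filter⁻ (λ y → ¬? (y ≟ k)) {xs = x ∷ k ∷ free ⟦ l ⟧} z∈
... | here refl , _          = x∈
... | there (here refl) , ≢k = contradiction refl ≢k
... | there (there z∈l) , ≢k = ∈-∷-≢ (Y⊆ (⟦⟧-free l z∈l)) ≢k

All-<-suc : All (_< k) X → All (_< suc k) X
All-<-suc = All.map ℕ.m≤n⇒m≤1+n

All-<-near : Y ⊆ k ∷ X → All (_< k) X → All (_< suc k) Y
All-<-near Y⊆ X<k = All.tabulate λ x∈Y → All.lookup (ℕ.≤-refl ∷ All-<-suc X<k) (Y⊆ x∈Y)

quantifierFree-FO⁺ : ∀ q {k} (φ : Formula σ) → qr φ ≡ 0 → All (_< k) (free φ) → md φ ≤ d →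
                     FO⁺ q k d φ
quantifierFree-FO⁺ zero    φ qr0 free<k md≤d = qr0 , free<k , md≤d
quantifierFree-FO⁺ (suc q) φ qr0 free<k md≤d =
  free<k , leaf (lower (quantifierFree-FO⁺ q φ qr0 (All-<-suc free<k) md≤d) free<k)

⟦⟧-FreeIn : (l : Bounded σ d q k m X) → All (_< k) X → FreeIn k ⟦ l ⟧
⟦⟧-FreeIn l X<k = All.tabulate (All.lookup X<k ∘ ⟦⟧-free l)

mutual
  ⟦⟧-FO⁺ : (l : Bounded σ d q k m X) → All (_< k) X → FO⁺ q k d ⟦ l ⟧
  ⟦⟧-FO⁺ {q = zero}  l X<k = rank0 l , ⟦⟧-FreeIn l X<k , md≤d l
    where
    rank0 : (l : Bounded σ d 0 k m X) → qr ⟦ l ⟧ ≡ 0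
    rank0 true         = refl
    rank0 (equal _ _)  = refl
    rank0 (atom _ _ _) = refl
    rank0 (dist _ _ _) = refl
    rank0 (not l)      = rank0 l
    rank0 (l ∧ l′)     = cong₂ _⊔_ (rank0 l) (rank0 l′)

    md≤d : (l : Bounded σ d 0 k m X) → md ⟦ l ⟧ ≤ d
    md≤d true          = z≤n
    md≤d (equal _ _)   = z≤n
    md≤d (atom _ _ _)  = z≤n
    md≤d (dist _ _ n≤) = n≤
    md≤d (not l)       = md≤d l
    md≤d (l ∧ l′)      = ℕ.⊔-lub (md≤d l) (md≤d l′)
  ⟦⟧-FO⁺ {q = suc q} l X<k = ⟦⟧-FreeIn l X<k , ⟦⟧-combination l X<k

  ⟦⟧-combination : (l : Bounded σ d (suc q) k m X) → All (_< k) X →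
    BooleanCombination (Generator (FO⁺ q (suc k) d) k (r₁ (suc q) k d) (r₁ q (suc k) d)) ⟦ l ⟧
  ⟦⟧-combination {q = q} true X<k =
    leaf (lower (quantifierFree-FO⁺ q true refl [] z≤n) [])
  ⟦⟧-combination {q = q} l@(equal _ _) X<k =
    let free<k = ⟦⟧-FreeIn l X<k
    in leaf (lower (quantifierFree-FO⁺ q ⟦ l ⟧ refl (All-<-suc free<k) z≤n) free<k)
  ⟦⟧-combination {q = q} l@(atom _ _ _) X<k =
    let free<k = ⟦⟧-FreeIn l X<k
    in leaf (lower (quantifierFree-FO⁺ q ⟦ l ⟧ refl (All-<-suc free<k) z≤n) free<k)
  ⟦⟧-combination (dist x∈ y∈ n≤) X<k = leaf (dist (All.lookup X<k x∈) (All.lookup X<k y∈) n≤)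
  ⟦⟧-combination (not l)    X<k = not (⟦⟧-combination l X<k)
  ⟦⟧-combination (l ∧ l′)   X<k = ⟦⟧-combination l X<k ∧ ⟦⟧-combination l′ X<k
  ⟦⟧-combination (lower _ l) X<k =
    leaf (lower (⟦⟧-FO⁺ l (All-<-suc X<k)) (⟦⟧-FreeIn (lower ℕ.≤-refl l) X<k))
  ⟦⟧-combination (near x∈ n≤ Y⊆ l) X<k =
    leaf (exNear (All.lookup X<k x∈) n≤ (⟦⟧-FO⁺ l (All-<-near Y⊆ X<k)))

-- `r₁ (suc q) k d` has the factor `k` and vanishes for `k = 0`, so comparisons of radii require
-- `0 < k`. Any variable in `X` provides it.
∈-positive : All (_< k) X → x ∈ X → 0 < k
∈-positive X<k x∈X = ℕ.≤-<-trans z≤n (All.lookup X<k x∈X)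

exNear-sat : (𝔸 : Structure σ) {α : Var → Carrier 𝔸} (ψ : Formula σ) → x < k →
  (𝔸 , α ⊨ ex k (dist≤ x k n ∧ ψ)) ⇔ (∃[ a ] (Dist≤ 𝔸 (α x) a n × (𝔸 , α [ k ↦ a ] ⊨ ψ)))
exNear-sat {x = x} {k} {n} 𝔸 {α} ψ x<k = ∃-⇔ λ a → dist-⇔ a ×-⇔ ⇔-id _
  where
  dist-⇔ : ∀ a → Dist≤ 𝔸 ((α [ k ↦ a ]) x) ((α [ k ↦ a ]) k) n ⇔ Dist≤ 𝔸 (α x) a n
  dist-⇔ a rewrite update-other α {a = a} (ℕ.<⇒≢ x<k) | update-same α k {a} = ⇔-id _

near-sat : (𝔸 : Structure σ) {α : Var → Carrier 𝔸} (ψ : Formula σ) (x∈X : x ∈ X) → All (_< k) X →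
  (𝔸 , α ⊨ ex k (dist≤ x k n ∧ ψ)) ⇔ (∃[ a ] (Dist≤ 𝔸 (α x) a n × (𝔸 , α [ k ↦ a ] ⊨ ψ)))
near-sat 𝔸 ψ x∈X X<k = exNear-sat 𝔸 ψ (All.lookup X<k x∈X)

update-∈ : (ρ : Var → Var) → (∀ {x} → x ∈ X → ρ x ∈ Y) → ∀ {x} → x ∈ k ∷ X → (ρ [ k ↦ k ]) x ∈ k ∷ Y
update-∈ {k = k} ρ ρ∈ {x} x∈ with x ≟ k
... | yes refl = here (update-same ρ k)
... | no x≢k   = there (subst (_∈ _) (sym (update-other ρ x≢k)) (ρ∈ (∈-∷-≢ x∈ x≢k)))

-- Unlike `rename`, this leaves bound variables in place, because the generators of `FO⁺` quantify
-- the variable `k` and no other. Capture is excluded in `substitute-sat` by `Y` lying below `k`.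
substitute : (ρ : Var → Var) → (∀ {x} → x ∈ X → ρ x ∈ Y) → Bounded σ d q k m X → Bounded σ d q k m Y
substitute ρ ρ∈ true             = true
substitute ρ ρ∈ (equal x∈ y∈)    = equal (ρ∈ x∈) (ρ∈ y∈)
substitute {Y = Y} ρ ρ∈ (atom R xs ⊆X) = atom R (Vec.map ρ xs) λ y∈ →
  let _ , x∈ , eq = ∈-map⁻ ρ (subst (_ ∈_) (toList-map ρ xs) y∈)
  in subst (_∈ Y) (sym eq) (ρ∈ (⊆X x∈))
substitute ρ ρ∈ (dist x∈ y∈ n≤)  = dist (ρ∈ x∈) (ρ∈ y∈) n≤
substitute ρ ρ∈ (not l)          = not (substitute ρ ρ∈ l)
substitute ρ ρ∈ (l ∧ l′)         = substitute ρ ρ∈ l ∧ substitute ρ ρ∈ l′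
substitute ρ ρ∈ (lower m≤ l)     = lower m≤ (substitute ρ ρ∈ l)
substitute ρ ρ∈ (near {k = k} x∈ n≤ Y⊆ l) =
  near (ρ∈ x∈) n≤ id (substitute (ρ [ k ↦ k ]) (update-∈ ρ ρ∈ ∘ Y⊆) l)

substitute-sat : (𝔸 : Structure σ) (ρ : Var → Var) (ρ∈ : ∀ {x} → x ∈ X → ρ x ∈ Y)
  (l : Bounded σ d q k m X) → All (_< k) X → All (_< k) Y →
  ∀ {α β} → Agree 𝔸 X (α ∘ ρ) β → (𝔸 , α ⊨ ⟦ substitute ρ ρ∈ l ⟧) ⇔ (𝔸 , β ⊨ ⟦ l ⟧)
substitute-sat 𝔸 ρ ρ∈ true          X<k Y<k eq = ⇔-id _
substitute-sat 𝔸 ρ ρ∈ (equal x∈ y∈) X<k Y<k eq rewrite eq x∈ | eq y∈ = ⇔-id _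
substitute-sat 𝔸 ρ ρ∈ (atom R xs ⊆X) X<k Y<k {α} eq
  rewrite sym (Vec.map-∘ α ρ xs) | map-agree 𝔸 xs (eq ∘ ⊆X) = ⇔-id _
substitute-sat 𝔸 ρ ρ∈ (dist x∈ y∈ _) X<k Y<k eq rewrite eq x∈ | eq y∈ = ⇔-id _
substitute-sat 𝔸 ρ ρ∈ (not l)     X<k Y<k eq = ¬-cong-⇔ (substitute-sat 𝔸 ρ ρ∈ l X<k Y<k eq)
substitute-sat 𝔸 ρ ρ∈ (l ∧ l′)    X<k Y<k eq =
  substitute-sat 𝔸 ρ ρ∈ l X<k Y<k eq ×-⇔ substitute-sat 𝔸 ρ ρ∈ l′ X<k Y<k eq
substitute-sat 𝔸 ρ ρ∈ (lower _ l) X<k Y<k eq =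
  substitute-sat 𝔸 ρ ρ∈ l (All-<-suc X<k) (All-<-suc Y<k) eq
substitute-sat 𝔸 ρ ρ∈ (near {x = x} {n = n} {k = k} x∈ _ Y⊆ l) X<k Y<k {α} {β} eq =
  ⇔-sym (near-sat 𝔸 ⟦ l ⟧ x∈ X<k)
  ⇔-∘ ((∃-⇔ λ a → dist-⇔ a ×-⇔
        substitute-sat 𝔸 (ρ [ k ↦ k ]) (update-∈ ρ ρ∈ ∘ Y⊆) l (All-<-near Y⊆ X<k)
          (ℕ.≤-refl ∷ All-<-suc Y<k) {α = α [ k ↦ a ]} {β = β [ k ↦ a ]} (eq′ a ∘ Y⊆))
  ⇔-∘ near-sat 𝔸 ⟦ substitute (ρ [ k ↦ k ]) (update-∈ ρ ρ∈ ∘ Y⊆) l ⟧ (ρ∈ x∈) Y<k)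
  where
  dist-⇔ : ∀ a → Dist≤ 𝔸 (α (ρ x)) a n ⇔ Dist≤ 𝔸 (β x) a n
  dist-⇔ a rewrite eq x∈ = ⇔-id _
  eq′ : ∀ a → Agree 𝔸 (k ∷ _) ((α [ k ↦ a ]) ∘ (ρ [ k ↦ k ])) (β [ k ↦ a ])
  eq′ a {z} z∈ with z ≟ k
  ... | yes refl rewrite update-same ρ k {k} =
    trans (update-same α k) (sym (update-same β k))
  ... | no z≢k rewrite update-other ρ {a = k} z≢k | update-other β {a = a} z≢k =
    trans (update-other α (ℕ.<⇒≢ (All.lookup Y<k (ρ∈ (∈-∷-≢ z∈ z≢k))))) (eq (∈-∷-≢ z∈ z≢k))

-- Locality of bounded formulas

module _ {𝔸 𝔹 : Structure σ} (e : Embedding 𝔹 𝔸) where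
  open Embedding e

  Covers : List Var → (Var → Carrier 𝔸) → ℕ → Set
  Covers X α r = ∀ {x a} → x ∈ X → Dist≤ 𝔸 (α x) a r → Image a

  map-embedding : ∀ {α β} (xs : Vec Var n) → (∀ {x} → x ∈ toList xs → α x ≡ fun (β x)) →
                  Vec.map α xs ≡ Vec.map fun (Vec.map β xs)
  map-embedding []       eq = refl
  map-embedding (x ∷ xs) eq = cong₂ _∷_ (eq (here refl)) (map-embedding xs (eq ∘ there))

  -- Induction along the recursion of `r₁`: a witness of `near` lies within `R ∸ R′` of some
  -- variable in `X`, so its own ball of radius `R′` is still inside the covered ball of radius `R`,
  -- and the body sees nothing outside the image.
  ⟦⟧-embedding : (l : Bounded σ d q k m X) → All (_< k) X →
    ∀ {α β} → Agree 𝔸 X α (fun ∘ β) → Covers X α (r₁ q k d) → (𝔸 , α ⊨ ⟦ l ⟧) ⇔ (𝔹 , β ⊨ ⟦ l ⟧)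
  ⟦⟧-embedding true          X<k eq cover = ⇔-id _
  ⟦⟧-embedding (equal x∈ y∈) X<k eq cover rewrite eq x∈ | eq y∈ = mk⇔ injective (cong fun)
  ⟦⟧-embedding (atom R xs ⊆X) X<k {β = β} eq cover
    rewrite map-embedding {β = β} xs (eq ∘ ⊆X) | preserves R (Vec.map β xs) = ⇔-id _
  ⟦⟧-embedding {q = q} (dist x∈ y∈ n≤) X<k eq cover
    rewrite eq y∈ =
      subst (λ a → Dist≤ 𝔸 a _ _ ⇔ _) (sym (eq x∈))
        (dist-embedding e λ δ → cover x∈ (subst (λ a → Dist≤ 𝔸 a _ _) (sym (eq x∈))
          (dist-mono 𝔸 (ℕ.≤-trans n≤ (distBound≤r₁ q)) δ)))
  ⟦⟧-embedding (not l)     X<k eq cover = ¬-cong-⇔ (⟦⟧-embedding l X<k eq cover)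
  ⟦⟧-embedding (l ∧ l′)    X<k eq cover =
    ⟦⟧-embedding l X<k eq cover ×-⇔ ⟦⟧-embedding l′ X<k eq cover
  ⟦⟧-embedding {q = suc q} (lower _ l) X<k eq cover = ⟦⟧-embedding l (All-<-suc X<k) eq
    λ x∈ → cover x∈ ∘ dist-mono 𝔸 (r₁-step q (∈-positive X<k x∈))
  ⟦⟧-embedding {d = d} {q = suc q} {k = k} {X = X} (near {x = x} {n = n} x∈ n≤ Y⊆ l) X<k
    {α} {β} eq cover =
    ⇔-sym (near-sat 𝔹 ⟦ l ⟧ x∈ X<k) ⇔-∘ (mk⇔ forth back ⇔-∘ near-sat 𝔸 ⟦ l ⟧ x∈ X<k)
    where
    0<k = ∈-positive X<k x∈
    R′≤R = r₁-step {d = d} q 0<k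
    n+R′≤R = near-radius {d = d} q 0<k n≤

    dist-⇔ : ∀ b → Dist≤ 𝔸 (α x) (fun b) n ⇔ Dist≤ 𝔹 (β x) b n
    dist-⇔ b = subst (λ a → Dist≤ 𝔸 a _ _ ⇔ _) (sym (eq x∈))
      (dist-embedding e λ δ → cover x∈ (subst (λ a → Dist≤ 𝔸 a _ _) (sym (eq x∈))
        (dist-mono 𝔸 (ℕ.m+n≤o⇒m≤o n n+R′≤R) δ)))

    body : ∀ b → Dist≤ 𝔸 (α x) (fun b) n →
           (𝔸 , α [ k ↦ fun b ] ⊨ ⟦ l ⟧) ⇔ (𝔹 , β [ k ↦ b ] ⊨ ⟦ l ⟧)
    body b δ = ⟦⟧-embedding l (All-<-near Y⊆ X<k) (eq′ ∘ Y⊆) (cover′ ∘ Y⊆)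
      where
      eq′ : Agree 𝔸 (k ∷ X) (α [ k ↦ fun b ]) (fun ∘ (β [ k ↦ b ]))
      eq′ {z} z∈ with z ≟ k
      ... | yes refl = trans (update-same α k) (cong fun (sym (update-same β k)))
      ... | no z≢k   =
        trans (update-other α z≢k) (trans (eq (∈-∷-≢ z∈ z≢k)) (cong fun (sym (update-other β z≢k))))
      cover′ : Covers (k ∷ X) (α [ k ↦ fun b ]) (r₁ q (suc k) d)
      cover′ {z} z∈ with z ≟ k
      ... | yes refl rewrite update-same α k {fun b} =
        cover x∈ ∘ dist-mono 𝔸 n+R′≤R ∘ dist-trans 𝔸 δ
      ... | no z≢k rewrite update-other α {a = fun b} z≢k =
        cover (∈-∷-≢ z∈ z≢k) ∘ dist-mono 𝔸 R′≤R

    forth : ∃[ a ] (Dist≤ 𝔸 (α x) a n × (𝔸 , α [ k ↦ a ] ⊨ ⟦ l ⟧)) →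
            ∃[ b ] (Dist≤ 𝔹 (β x) b n × (𝔹 , β [ k ↦ b ] ⊨ ⟦ l ⟧))
    forth (a , δ , sat) with cover x∈ (dist-mono 𝔸 (ℕ.m+n≤o⇒m≤o n n+R′≤R) δ)
    ... | b , refl = b , to (dist-⇔ b) δ , to (body b δ) sat

    back : ∃[ b ] (Dist≤ 𝔹 (β x) b n × (𝔹 , β [ k ↦ b ] ⊨ ⟦ l ⟧)) →
           ∃[ a ] (Dist≤ 𝔸 (α x) a n × (𝔸 , α [ k ↦ a ] ⊨ ⟦ l ⟧))
    back (b , δ , sat) =
      let δ′ = from (dist-⇔ b) δ in fun b , δ′ , from (body b δ′) sat

neighbourhood-embedding : (𝔸 : Structure σ) (r : ℕ) (ā : Vec (Carrier 𝔸) (suc n)) →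
                          Embedding (Neighbourhood 𝔸 r ā) 𝔸
neighbourhood-embedding 𝔸 r ā = record
  { fun = value ; injective = value-injective ; preserves = λ _ _ → refl }

map-≡⁻ : ∀ {A : Set} {f g : Var → A} (xs : Vec Var n) → Vec.map f xs ≡ Vec.map g xs →
         x ∈ toList xs → f x ≡ g x
map-≡⁻ (_ ∷ xs) eq (here refl) = Vec.∷-injectiveˡ eq
map-≡⁻ (_ ∷ xs) eq (there x∈)  = map-≡⁻ xs (Vec.∷-injectiveʳ eq) x∈

-- The variable 0 only makes the tuple non-empty.
⟦⟧-local : (l : Bounded σ d q k m X) → All (_< k) X → IsLocal (r₁ q k d) ⟦ l ⟧
⟦⟧-local {σ} {d} {q} {k} {X = X} l X<k = _ , 0 ∷ Vec.fromList X , X⊆ ∘ ⟦⟧-free l , local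
  where
  X⊆ : X ⊆ 0 ∷ toList (Vec.fromList X)
  X⊆ x∈X = there (subst (_ ∈_) (sym (Vec.toList∘fromList X)) x∈X)

  local : (𝔸 : Structure σ) (ā : Vec (Carrier 𝔸) (suc (List.length X))) (α : Var → Carrier 𝔸)
    (β : Var → Carrier (Neighbourhood 𝔸 (r₁ q k d) ā)) →
    Vec.map α (0 ∷ Vec.fromList X) ≡ ā → Vec.map (value ∘ β) (0 ∷ Vec.fromList X) ≡ ā →
    (𝔸 , α ⊨ ⟦ l ⟧) ⇔ (Neighbourhood 𝔸 (r₁ q k d) ā , β ⊨ ⟦ l ⟧)
  local 𝔸 ā α β refl eq = ⟦⟧-embedding (neighbourhood-embedding 𝔸 (r₁ q k d) ā) l X<k
    (map-≡⁻ (0 ∷ Vec.fromList X) (sym eq) ∘ X⊆)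
    λ x∈X δ → (_ , [ VecAny.map⁺ (VecAny.map (λ { refl → δ })
                         (VecMembership.∈-toList⁻ (X⊆ x∈X))) ]) , refl

-- Separating distant variables

-- Mixes are formed twice: from bounded formulas about two distant groups of variables, and from a
-- sentence with a bounded formula.
record Connectives (σ : Signature) : Set₁ where
  infixr 6 _∧ᵗ_
  field
    Term    : Set
    formula : Term → Formula σ
    ⊤ᵗ      : Term
    ¬ᵗ      : Term → Term
    _∧ᵗ_    : Term → Term → Term
    sat-⊤   : ∀ 𝔸 {α} → 𝔸 , α ⊨ formula ⊤ᵗ
    sat-¬   : ∀ 𝔸 {α} s → (𝔸 , α ⊨ formula (¬ᵗ s)) ⇔ (¬ (𝔸 , α ⊨ formula s))
    sat-∧   : ∀ 𝔸 {α} s t →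
              (𝔸 , α ⊨ formula (s ∧ᵗ t)) ⇔ ((𝔸 , α ⊨ formula s) × (𝔸 , α ⊨ formula t))

boundedConnectives : (σ : Signature) (d q k m : ℕ) (X : List Var) → Connectives σ
boundedConnectives σ d q k m X = record
  { Term    = Bounded σ d q k m X
  ; formula = ⟦_⟧
  ; ⊤ᵗ      = true
  ; ¬ᵗ      = not
  ; _∧ᵗ_    = _∧_
  ; sat-⊤   = λ _ → tt
  ; sat-¬   = λ _ _ → ⇔-id _
  ; sat-∧   = λ _ _ _ → ⇔-id _
  }

-- A list of pairs stands for the disjunction of the conjunctions of its pairs.
module Mixed {σ : Signature} (P Q : Connectives σ) where
  private
    module P = Connectives P
    module Q = Connectives Q

  Mix : Set
  Mix = List (P.Term × Q.Term)

  Holds : (𝔸 : Structure σ) → (Var → Carrier 𝔸) → P.Term × Q.Term → Set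
  Holds 𝔸 α (p , q) = (𝔸 , α ⊨ P.formula p) × (𝔸 , α ⊨ Q.formula q)

  infix 3 _,_⊩_
  _,_⊩_ : (𝔸 : Structure σ) → (Var → Carrier 𝔸) → Mix → Set
  𝔸 , α ⊩ ms = Any (Holds 𝔸 α) ms

  left : P.Term → Mix
  left p = (p , Q.⊤ᵗ) ∷ []

  right : Q.Term → Mix
  right q = (P.⊤ᵗ , q) ∷ []

  ⊤ᵐ : Mix
  ⊤ᵐ = (P.⊤ᵗ , Q.⊤ᵗ) ∷ []

  infixr 6 _∧ᵐ_
  _∧ᵐ_ : Mix → Mix → Mix
  _∧ᵐ_ = cartesianProductWith λ (p , q) (p′ , q′) → (p P.∧ᵗ p′) , (q Q.∧ᵗ q′)

  -- De Morgan on a disjunctive normal form, with the resulting conjunction of disjunctions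
  -- multiplied out again by `_∧ᵐ_`.
  ¬ᵐ : Mix → Mix
  ¬ᵐ []             = ⊤ᵐ
  ¬ᵐ ((p , q) ∷ ms) = (left (P.¬ᵗ p) ++ right (Q.¬ᵗ q)) ∧ᵐ ¬ᵐ ms

  module _ (𝔸 : Structure σ) {α : Var → Carrier 𝔸} where

    left-sat : ∀ p → (𝔸 , α ⊩ left p) ⇔ (𝔸 , α ⊨ P.formula p)
    left-sat p = mk⇔ (λ { (here (h , _)) → h }) (λ h → here (h , Q.sat-⊤ 𝔸))

    right-sat : ∀ q → (𝔸 , α ⊩ right q) ⇔ (𝔸 , α ⊨ Q.formula q)
    right-sat p = mk⇔ (λ { (here (_ , h)) → h }) (λ h → here (P.sat-⊤ 𝔸 , h))

    ⊤ᵐ-sat : 𝔸 , α ⊩ ⊤ᵐ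
    ⊤ᵐ-sat = here (P.sat-⊤ 𝔸 , Q.sat-⊤ 𝔸)

    ++-sat : ∀ ms ns → (𝔸 , α ⊩ ms ++ ns) ⇔ ((𝔸 , α ⊩ ms) ⊎ (𝔸 , α ⊩ ns))
    ++-sat ms ns = mk⇔ (Any.++⁻ ms) Sum.[ Any.++⁺ˡ , Any.++⁺ʳ ms ]′

    ∧ᵐ-sat : ∀ ms ns → (𝔸 , α ⊩ ms ∧ᵐ ns) ⇔ ((𝔸 , α ⊩ ms) × (𝔸 , α ⊩ ns))
    ∧ᵐ-sat ms ns = mk⇔
      (Any.cartesianProductWith⁻ _
        (λ {(p , q)} {(p′ , q′)} (hp , hq) →
          let h₁ , h₁′ = to (P.sat-∧ 𝔸 p p′) hp ; h₂ , h₂′ = to (Q.sat-∧ 𝔸 q q′) hq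
          in (h₁ , h₂) , (h₁′ , h₂′)) ms ns)
      (uncurry (Any.cartesianProductWith⁺ _
        (λ {(p , q)} {(p′ , q′)} (h₁ , h₂) (h₁′ , h₂′) →
          from (P.sat-∧ 𝔸 p p′) (h₁ , h₁′) , from (Q.sat-∧ 𝔸 q q′) (h₂ , h₂′))))

    ¬ᵐ-sat : ∀ ms → (𝔸 , α ⊩ ¬ᵐ ms) ⇔ (¬ (𝔸 , α ⊩ ms))
    ¬ᵐ-sat []             = mk⇔ (λ _ ()) (λ _ → ⊤ᵐ-sat)
    ¬ᵐ-sat ((p , q) ∷ ms) = mk⇔ forth back ⇔-∘ ∧ᵐ-sat _ (¬ᵐ ms)
      where
      forth : (𝔸 , α ⊩ left (P.¬ᵗ p) ++ right (Q.¬ᵗ q)) × (𝔸 , α ⊩ ¬ᵐ ms) →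
              ¬ (𝔸 , α ⊩ (p , q) ∷ ms)
      forth (here (h , _) , _)         (here (hp , _)) = to (P.sat-¬ 𝔸 p) h hp
      forth (there (here (_ , h)) , _) (here (_ , hq)) = to (Q.sat-¬ 𝔸 q) h hq
      forth (_ , h)                    (there hms)     = to (¬ᵐ-sat ms) h hms
      back : ¬ (𝔸 , α ⊩ (p , q) ∷ ms) →
             (𝔸 , α ⊩ left (P.¬ᵗ p) ++ right (Q.¬ᵗ q)) × (𝔸 , α ⊩ ¬ᵐ ms)
      back ¬h with sat? 𝔸 α (P.formula p) | from (¬ᵐ-sat ms) (¬h ∘ there)
      ... | no ¬hp | h = here (from (P.sat-¬ 𝔸 p) ¬hp , Q.sat-⊤ 𝔸) , h
      ... | yes hp | h =
        there (here (P.sat-⊤ 𝔸 , from (Q.sat-¬ 𝔸 q) λ hq → ¬h (here (hp , hq)))) , h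

-- Existential quantification, guarded by `D`, distributes over disjunction. It moves `near` inside
-- the pairs of a mix, where one component does not depend on the witness.
any-∃ : ∀ {A B : Set} {P : A → Set} {D : B → Set} {Q : B → A → Set} (xs : List A) →
        (∀ x → P x ⇔ (∃[ b ] (D b × Q b x))) → Any P xs ⇔ (∃[ b ] (D b × Any (Q b) xs))
any-∃ {P = P} {D} {Q} xs P⇔ = mk⇔ forth
  λ (b , δ , h) → Any.map (λ {x} hx → from (P⇔ x) (b , δ , hx)) h
  where
  forth : ∀ {xs} → Any P xs → ∃[ b ] (D b × Any (Q b) xs)
  forth (here h)  = let b , δ , h′ = to (P⇔ _) h in b , δ , here h′
  forth (there h) = let b , δ , h′ = forth h in b , δ , there h′

×-⇔-dependent : ∀ {A B C : Set} → (A → B ⇔ C) → (A × B) ⇔ (A × C)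
×-⇔-dependent f = mk⇔ (λ (a , b) → a , to (f a) b) (λ (a , c) → a , from (f a) c)

Separated : (σ : Signature) (d q k m : ℕ) (Y Z : List Var) → Set
Separated σ d q k m Y Z =
  Mixed.Mix (boundedConnectives σ d q k m Y) (boundedConnectives σ d q k m Z)

module _ {σ : Signature} {d q k m : ℕ} {Y Z : List Var} where
  open Mixed (boundedConnectives σ d q k m Y) (boundedConnectives σ d q k m Z) public
    using (_,_⊩_; ⊤ᵐ; _∧ᵐ_; ¬ᵐ; left; right; ⊤ᵐ-sat; left-sat; right-sat; ∧ᵐ-sat; ¬ᵐ-sat)

Splits : (X Y Z : List Var) → Set
Splits X Y Z = ∀ {x} → x ∈ X → x ∈ Y ⊎ x ∈ Z

-- The last alternative exhibits two variables of one atom in different groups, which falsifies the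
-- atom once the groups are far apart. An atom of arity 0 goes to `Y`.
splitAll : (xs : List Var) → Splits xs Y Z →
           xs ⊆ Y ⊎ xs ⊆ Z ⊎ ∃[ y ] ∃[ z ] (y ∈ xs × z ∈ xs × y ∈ Y × z ∈ Z)
splitAll []       split = inj₁ λ ()
splitAll (x ∷ xs) split with split (here refl) | splitAll xs (split ∘ there)
... | inj₁ x∈Y | inj₁ xs⊆Y        = inj₁ λ { (here refl) → x∈Y ; (there x∈) → xs⊆Y x∈ }
... | inj₂ x∈Z | inj₂ (inj₁ xs⊆Z) = inj₂ (inj₁ λ { (here refl) → x∈Z ; (there x∈) → xs⊆Z x∈ })
... | inj₂ x∈Z | inj₁ xs⊆Y with xs
...   | []     = inj₂ (inj₁ λ { (here refl) → x∈Z })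
...   | y ∷ ys = inj₂ (inj₂ (y , x , there (here refl) , here refl , xs⊆Y (here refl) , x∈Z))
splitAll (x ∷ xs) split | inj₁ x∈Y | inj₂ (inj₁ xs⊆Z) with xs
...   | []     = inj₁ λ { (here refl) → x∈Y }
...   | z ∷ zs = inj₂ (inj₂ (x , z , here refl , there (here refl) , x∈Y , xs⊆Z (here refl)))
splitAll (x ∷ xs) split | _ | inj₂ (inj₂ (y , z , y∈ , z∈ , y∈Y , z∈Z)) =
  inj₂ (inj₂ (y , z , there y∈ , there z∈ , y∈Y , z∈Z))

splits-∷ˡ : X ⊆ k ∷ W → Splits W Y Z → Splits X (k ∷ Y) Z
splits-∷ˡ X⊆ split x∈ with X⊆ x∈
... | here refl = inj₁ (here refl)
... | there x∈′ = Sum.map₁ there (split x∈′)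

splits-∷ʳ : X ⊆ k ∷ W → Splits W Y Z → Splits X Y (k ∷ Z)
splits-∷ʳ X⊆ split x∈ with X⊆ x∈
... | here refl = inj₂ (here refl)
... | there x∈′ = Sum.map₂ there (split x∈′)

-- A formula whose variables fall into two groups that are far apart says
-- something about each group separately: every atom involving both is false.
separate : Splits X Y Z → Bounded σ d q k m X → Separated σ d q k m Y Z
separate split true = ⊤ᵐ
separate split (equal x∈ y∈) with split x∈ | split y∈
... | inj₁ x∈Y | inj₁ y∈Y = left (equal x∈Y y∈Y)
... | inj₂ x∈Z | inj₂ y∈Z = right (equal x∈Z y∈Z)
... | inj₁ _   | inj₂ _   = []
... | inj₂ _   | inj₁ _   = []
separate split (atom R xs xs⊆X) with splitAll (toList xs) (split ∘ xs⊆X)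
... | inj₁ xs⊆Y        = left (atom R xs xs⊆Y)
... | inj₂ (inj₁ xs⊆Z) = right (atom R xs xs⊆Z)
... | inj₂ (inj₂ _)    = []
separate split (dist x∈ y∈ n≤) with split x∈ | split y∈
... | inj₁ x∈Y | inj₁ y∈Y = left (dist x∈Y y∈Y n≤)
... | inj₂ x∈Z | inj₂ y∈Z = right (dist x∈Z y∈Z n≤)
... | inj₁ _   | inj₂ _   = []
... | inj₂ _   | inj₁ _   = []
separate split (not l)      = ¬ᵐ (separate split l)
separate split (l ∧ l′)     = separate split l ∧ᵐ separate split l′
separate split (lower m≤ l) = map (Product.map (lower m≤) (lower m≤)) (separate split l)
separate split (near x∈ n≤ Y⊆ l) with split x∈
... | inj₁ x∈Y = map (Product.map (near x∈Y n≤ id) (lower (ℕ.n≤1+n _)))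
                     (separate (splits-∷ˡ Y⊆ split) l)
... | inj₂ x∈Z = map (Product.map (lower (ℕ.n≤1+n _)) (near x∈Z n≤ id))
                     (separate (splits-∷ʳ Y⊆ split) l)

module _ (𝔸 : Structure σ) where

  Far : (Y Z : List Var) → (Var → Carrier 𝔸) → ℕ → Set
  Far Y Z α r = ∀ {y z} → y ∈ Y → z ∈ Z → ¬ Dist≤ 𝔸 (α y) (α z) r

  far-sym : ∀ {α r} → Far Y Z α r → Far Z Y α r
  far-sym far z∈ y∈ = far y∈ z∈ ∘ dist-sym 𝔸

  -- The witness joins the group of the variable it is near to, at the price of `n` in the distance
  -- between the groups. By `near-radius` the remainder still suffices for the body.
  far-update : ∀ {α r a} → All (_< k) Y → All (_< k) Z → Far Y Z α (n + r) →
    x ∈ Y → Dist≤ 𝔸 (α x) a n → Far (k ∷ Y) Z (α [ k ↦ a ]) r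
  far-update {k} {n = n} {α = α} {r} {a = a} Y<k Z<k far x∈Y δ {y} {z} y∈ z∈
    rewrite update-other α {a = a} (ℕ.<⇒≢ (All.lookup Z<k z∈)) with y ≟ k
  ... | yes refl rewrite update-same α k {a} = far x∈Y z∈ ∘ dist-trans 𝔸 δ
  ... | no y≢k rewrite update-other α {a = a} y≢k =
    far (∈-∷-≢ y∈ y≢k) z∈ ∘ dist-mono 𝔸 (ℕ.m≤n+m r n)

  ⟦⟧-update : ∀ {α a} (l : Bounded σ d q k m X) → All (_< n) X →
              (𝔸 , α [ n ↦ a ] ⊨ ⟦ l ⟧) ⇔ (𝔸 , α ⊨ ⟦ l ⟧)
  ⟦⟧-update {α = α} l X<n =
    coincidence 𝔸 ⟦ l ⟧ λ x∈ → update-other α (ℕ.<⇒≢ (All.lookup X<n (⟦⟧-free l x∈)))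

  near-left-sat : ∀ {α} (x∈Y : x ∈ Y) (n≤ : n ≤ r₁ (suc q) k d ∸ r₁ q (suc k) d) →
    All (_< k) Y → All (_< k) Z → (ms : Separated σ d q (suc k) m (k ∷ Y) Z) →
    (𝔸 , α ⊩ map (Product.map (near x∈Y n≤ id) (lower (ℕ.n≤1+n m))) ms) ⇔
    (∃[ a ] (Dist≤ 𝔸 (α x) a n × (𝔸 , α [ k ↦ a ] ⊩ ms)))
  near-left-sat x∈Y n≤ Y<k Z<k ms = any-∃ ms (λ (p , q) → mk⇔
    (λ (hp , hq) → let a , δ , hp′ = to (near-sat 𝔸 ⟦ p ⟧ x∈Y Y<k) hp
                   in a , δ , hp′ , from (⟦⟧-update q Z<k) hq)
    (λ (a , δ , hp , hq) → from (near-sat 𝔸 ⟦ p ⟧ x∈Y Y<k) (a , δ , hp) , to (⟦⟧-update q Z<k) hq))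
    ⇔-∘ mk⇔ Any.map⁻ Any.map⁺

  near-right-sat : ∀ {α} (x∈Z : x ∈ Z) (n≤ : n ≤ r₁ (suc q) k d ∸ r₁ q (suc k) d) →
    All (_< k) Y → All (_< k) Z → (ms : Separated σ d q (suc k) m Y (k ∷ Z)) →
    (𝔸 , α ⊩ map (Product.map (lower (ℕ.n≤1+n m)) (near x∈Z n≤ id)) ms) ⇔
    (∃[ a ] (Dist≤ 𝔸 (α x) a n × (𝔸 , α [ k ↦ a ] ⊩ ms)))
  near-right-sat x∈Z n≤ Y<k Z<k ms = any-∃ ms (λ (p , q) → mk⇔
    (λ (hp , hq) → let a , δ , hq′ = to (near-sat 𝔸 ⟦ q ⟧ x∈Z Z<k) hq
                   in a , δ , from (⟦⟧-update p Y<k) hp , hq′)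
    (λ (a , δ , hp , hq) → to (⟦⟧-update p Y<k) hp , from (near-sat 𝔸 ⟦ q ⟧ x∈Z Z<k) (a , δ , hq)))
    ⇔-∘ mk⇔ Any.map⁻ Any.map⁺

  -- The distance `r₁ q k d` refutes every atom across the groups: it is at least 1, which settles
  -- equalities and tuples, and at least `distBound q k d`, which settles distance atoms.
  separate-sat : (split : Splits X Y Z) (l : Bounded σ d q k m X) →
    All (_< k) X → All (_< k) Y → All (_< k) Z → ∀ {α} → Far Y Z α (r₁ q k d) →
    (𝔸 , α ⊩ separate split l) ⇔ (𝔸 , α ⊨ ⟦ l ⟧)
  separate-sat split true X<k Y<k Z<k far = mk⇔ (λ _ → tt) (λ _ → ⊤ᵐ-sat 𝔸)
  separate-sat split (equal x∈ y∈) X<k Y<k Z<k far with split x∈ | split y∈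
  ... | inj₁ x∈Y | inj₁ y∈Y = left-sat 𝔸 _
  ... | inj₂ x∈Z | inj₂ y∈Z = right-sat 𝔸 _
  ... | inj₁ x∈Y | inj₂ y∈Z =
    mk⇔ (λ ()) λ eq → contradiction (0 , z≤n , eq) (far x∈Y y∈Z)
  ... | inj₂ x∈Z | inj₁ y∈Y =
    mk⇔ (λ ()) λ eq → contradiction (0 , z≤n , sym eq) (far y∈Y x∈Z)
  separate-sat {q = q} split (atom R xs xs⊆X) X<k Y<k Z<k {α} far
    with splitAll (toList xs) (split ∘ xs⊆X)
  ... | inj₁ xs⊆Y        = left-sat 𝔸 _
  ... | inj₂ (inj₁ xs⊆Z) = right-sat 𝔸 _
  ... | inj₂ (inj₂ (y , z , y∈ , z∈ , y∈Y , z∈Z)) = mk⇔ (λ ()) λ h →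
    contradiction (dist-mono 𝔸 (r₁-pos q (∈-positive Y<k y∈Y))
                    (dist-tuple 𝔸 R h (∈-image y∈) (∈-image z∈)))
                  (far y∈Y z∈Z)
    where
    ∈-image : ∀ {x} → x ∈ toList xs → α x ∈ᵛ Vec.map α xs
    ∈-image = VecMembership.∈-map⁺ α ∘ VecMembership.∈-toList⁻
  separate-sat {q = q} split (dist x∈ y∈ n≤) X<k Y<k Z<k far with split x∈ | split y∈
  ... | inj₁ x∈Y | inj₁ y∈Y = left-sat 𝔸 _
  ... | inj₂ x∈Z | inj₂ y∈Z = right-sat 𝔸 _
  ... | inj₁ x∈Y | inj₂ y∈Z =
    mk⇔ (λ ()) λ δ → contradiction (dist-mono 𝔸 (ℕ.≤-trans n≤ (distBound≤r₁ q)) δ) (far x∈Y y∈Z)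
  ... | inj₂ x∈Z | inj₁ y∈Y =
    mk⇔ (λ ()) λ δ → contradiction (dist-mono 𝔸 (ℕ.≤-trans n≤ (distBound≤r₁ q)) (dist-sym 𝔸 δ))
                                   (far y∈Y x∈Z)
  separate-sat split (not l) X<k Y<k Z<k far =
    ¬-cong-⇔ (separate-sat split l X<k Y<k Z<k far) ⇔-∘ ¬ᵐ-sat 𝔸 (separate split l)
  separate-sat split (l ∧ l′) X<k Y<k Z<k far =
    (separate-sat split l X<k Y<k Z<k far ×-⇔ separate-sat split l′ X<k Y<k Z<k far)
    ⇔-∘ ∧ᵐ-sat 𝔸 (separate split l) (separate split l′)
  separate-sat {q = suc q} split (lower m≤ l) X<k Y<k Z<k far =
    separate-sat split l (All-<-suc X<k) (All-<-suc Y<k) (All-<-suc Z<k)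
      (λ y∈ z∈ → far y∈ z∈ ∘ dist-mono 𝔸 (r₁-step q (∈-positive Y<k y∈)))
    ⇔-∘ mk⇔ Any.map⁻ Any.map⁺
  separate-sat {d = d} {q = suc q} {k = k} split (near {n = n} x∈ n≤ Y⊆ l) X<k Y<k Z<k {α} far
    with split x∈
  ... | inj₁ x∈Y = ⇔-sym (near-sat 𝔸 ⟦ l ⟧ x∈ X<k)
    ⇔-∘ ((∃-⇔ λ a → ×-⇔-dependent λ δ → separate-sat (splits-∷ˡ Y⊆ split) l (All-<-near Y⊆ X<k)
           (ℕ.≤-refl ∷ All-<-suc Y<k) (All-<-suc Z<k) (far-update Y<k Z<k far′ x∈Y δ))
    ⇔-∘ near-left-sat x∈Y n≤ Y<k Z<k (separate (splits-∷ˡ Y⊆ split) l))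
    where
    far′ : Far _ _ α (n + r₁ q (suc k) d)
    far′ y∈ z∈ = far y∈ z∈ ∘ dist-mono 𝔸 (near-radius q (∈-positive X<k x∈) n≤)
  ... | inj₂ x∈Z = ⇔-sym (near-sat 𝔸 ⟦ l ⟧ x∈ X<k)
    ⇔-∘ ((∃-⇔ λ a → ×-⇔-dependent λ δ → separate-sat (splits-∷ʳ Y⊆ split) l (All-<-near Y⊆ X<k)
           (All-<-suc Y<k) (ℕ.≤-refl ∷ All-<-suc Z<k)
           (far-sym (far-update Z<k Y<k (far-sym far′) x∈Z δ)))
    ⇔-∘ near-right-sat x∈Z n≤ Y<k Z<k (separate (splits-∷ʳ Y⊆ split) l))
    where
    far′ : Far _ _ α (n + r₁ q (suc k) d)
    far′ y∈ z∈ = far y∈ z∈ ∘ dist-mono 𝔸 (near-radius q (∈-positive X<k x∈) n≤)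

-- Scattered sets and basic local sentences

⋀-sat : (𝔸 : Structure σ) {α : Var → Carrier 𝔸} (φs : List (Formula σ)) →
        (𝔸 , α ⊨ ⋀ φs) ⇔ All (𝔸 , α ⊨_) φs
⋀-sat 𝔸 []       = mk⇔ (λ _ → []) (λ _ → tt)
⋀-sat 𝔸 (φ ∷ φs) = mk⇔ (λ (h , hs) → h ∷ to (⋀-sat 𝔸 φs) hs)
                        (λ { (h ∷ hs) → h , from (⋀-sat 𝔸 φs) hs })

⋀-free : (φs : List (Formula σ)) → x ∈ free (⋀ φs) → Any (λ φ → x ∈ free φ) φs
⋀-free (φ ∷ φs) x∈ with ∈-++⁻ (free φ) x∈
... | inj₁ x∈φ  = here x∈φ
... | inj₂ x∈φs = there (⋀-free φs x∈φs)

-- The whole block becomes one choice of an assignment, so the matrix need not be evaluated under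
-- nested updates.
ex*-sat : (𝔸 : Structure σ) (ys : List Var) (φ : Formula σ) {α : Var → Carrier 𝔸} →
  (𝔸 , α ⊨ ex* ys φ) ⇔ (∃[ f ] ((∀ v → v ∉ ys → f v ≡ α v) × (𝔸 , f ⊨ φ)))
ex*-sat 𝔸 [] φ {α} = mk⇔ (λ h → α , (λ _ _ → refl) , h)
  (λ (f , eq , h) → to (coincidence 𝔸 φ λ _ → eq _ λ ()) h)
ex*-sat 𝔸 (y ∷ ys) φ {α} = mk⇔ forth back
  where
  forth : _ → _
  forth (a , h) with f , eq , h′ ← to (ex*-sat 𝔸 ys φ) h =
    f , (λ v v∉ → trans (eq v (v∉ ∘ there)) (update-other α (v∉ ∘ here))) , h′
  back : _ → _
  back (f , eq , h) = f y , from (ex*-sat 𝔸 ys φ) (f , eq′ , h)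
    where
    eq′ : ∀ v → v ∉ ys → f v ≡ (α [ y ↦ f y ]) v
    eq′ v v∉ys with v ≟ y
    ... | yes refl = sym (update-same α y)
    ... | no v≢y   = trans (eq v λ { (here v≡y) → v≢y v≡y ; (there v∈ys) → v∉ys v∈ys })
                           (sym (update-other α v≢y))

ex*-free : ∀ ys {φ : Formula σ} → x ∈ free (ex* ys φ) → x ∈ free φ × x ∉ ys
ex*-free []       x∈ = x∈ , λ ()
ex*-free (y ∷ ys) {φ} x∈ with ∈-filter⁻ (λ z → ¬? (z ≟ y)) {xs = free (ex* ys φ)} x∈
... | x∈′ , x≢y with ex*-free ys x∈′
... | x∈φ , x∉ys = x∈φ , λ { (here x≡y) → x≢y x≡y ; (there x∈ys) → x∉ys x∈ys }

pairs-All : ∀ {P : A × A → Set} xs → All P (pairs xs) ⇔ AllPairs (curry P) xs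
pairs-All []       = mk⇔ (λ _ → []) (λ _ → [])
pairs-All (x ∷ xs) = mk⇔
  (λ h → All.map⁻ (All.++⁻ˡ (map (x ,_) xs) h) ∷ to (pairs-All xs) (All.++⁻ʳ (map (x ,_) xs) h))
  (λ { (h ∷ hs) → All.++⁺ (All.map⁺ h) (from (pairs-All xs) hs) })

∈-pairs : ∀ {p : A × A} xs → p ∈ pairs xs → proj₁ p ∈ xs × proj₂ p ∈ xs
∈-pairs (x ∷ xs) p∈ with ∈-++⁻ (map (x ,_) xs) p∈
... | inj₂ p∈′ = Product.map there there (∈-pairs xs p∈′)
... | inj₁ p∈′ with _ , y∈xs , refl ← ∈-map⁻ (x ,_) p∈′ = here refl , there y∈xs

overwrite : List A → (ℕ → A) → ℕ → A
overwrite []       α i       = α i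
overwrite (p ∷ ps) α zero    = p
overwrite (p ∷ ps) α (suc i) = overwrite ps (α ∘ suc) i

overwrite-≥ : ∀ (ps : List A) α {i} → length ps ≤ i → overwrite ps α i ≡ α i
overwrite-≥ []       α _         = refl
overwrite-≥ (p ∷ ps) α (s≤s ≤i)  = overwrite-≥ ps (α ∘ suc) ≤i

applyUpTo-overwrite : ∀ (ps : List A) α → applyUpTo (overwrite ps α) (length ps) ≡ ps
applyUpTo-overwrite []       α = refl
applyUpTo-overwrite (p ∷ ps) α = cong (p ∷_) (applyUpTo-overwrite ps (α ∘ suc))

module _ (𝔸 : Structure σ) where

  Scattered : (Carrier 𝔸 → Set) → (r n : ℕ) → Set
  Scattered P r n = ∃[ ps ] (length ps ≡ n × All P ps ×
    AllPairs (λ p p′ → ¬ Dist≤ 𝔸 p p′ (2 * r)) ps)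

  scattered-sat : ∀ n r (φ : Formula σ) → free φ ⊆ x₁ ∷ [] → ∀ {α} →
    (𝔸 , α ⊨ scattered (upTo n) r φ) ⇔ Scattered (λ p → 𝔸 , const p ⊨ φ) r n
  scattered-sat n r φ φ-free {α} = mk⇔ forth back ⇔-∘ ex*-sat 𝔸 (upTo n) matrix
    where
    matrix = ⋀ (List.map (λ (y , y′) → dist> y y′ (2 * r)) (pairs (upTo n))) ∧
             ⋀ (List.map (λ y → rename (id [ x₁ ↦ y ]) φ) (upTo n))

    apart : ∀ f → (𝔸 , f ⊨ ⋀ (List.map (λ (y , y′) → dist> y y′ (2 * r)) (pairs (upTo n)))) ⇔
                  AllPairs (λ y y′ → ¬ Dist≤ 𝔸 (f y) (f y′) (2 * r)) (upTo n)
    apart f = pairs-All (upTo n) ⇔-∘ (mk⇔ All.map⁻ All.map⁺ ⇔-∘ ⋀-sat 𝔸 _)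

    φ-at : ∀ f y → (𝔸 , f ⊨ rename (id [ x₁ ↦ y ]) φ) ⇔ (𝔸 , const (f y) ⊨ φ)
    φ-at f y = coincidence 𝔸 φ (agree ∘ φ-free) ⇔-∘ rename-sat 𝔸 φ
      where
      agree : ∀ {x} → x ∈ x₁ ∷ [] → f ((id [ x₁ ↦ y ]) x) ≡ f y
      agree (here refl) = refl

    forth : ∃[ f ] ((∀ v → v ∉ upTo n → f v ≡ α v) × (𝔸 , f ⊨ matrix)) → _
    forth (f , _ , h , h′) = map f (upTo n) ,
      trans (List.length-map f (upTo n)) (List.length-upTo n) ,
      All.map⁺ (All.map (to (φ-at f _)) (All.map⁻ (to (⋀-sat 𝔸 _) h′))) ,
      AllPairs.map⁺ (to (apart f) h)

    back : Scattered (λ p → 𝔸 , const p ⊨ φ) r n → _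
    back (ps , refl , Pps , far) = f ,
      (λ v v∉ → overwrite-≥ ps α (ℕ.≮⇒≥ (v∉ ∘ ∈-upTo⁺))) ,
      from (apart f) (AllPairs.map⁻ (subst (AllPairs _) (sym ps≡) far)) ,
      from (⋀-sat 𝔸 _)
        (All.map⁺ (All.map (from (φ-at f _)) (All.map⁻ (subst (All _) (sym ps≡) Pps))))
      where
      f = overwrite ps α
      ps≡ : map f (upTo n) ≡ ps
      ps≡ = trans (List.map-upTo f n) (applyUpTo-overwrite ps α)

scattered-closed : ∀ ys r (φ : Formula σ) → free φ ⊆ x₁ ∷ [] → x ∉ free (scattered ys r φ)
scattered-closed {σ = σ} {x} ys r φ φ-free x∈ with ex*-free ys x∈
... | x∈matrix , x∉ys = Sum.[ in-apart , in-φ ]′ (∈-++⁻ (free (⋀ apart)) x∈matrix)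
  where
  apart = List.map (λ (y , y′) → dist> {σ} y y′ (2 * r)) (pairs ys)

  in-apart : x ∉ free (⋀ apart)
  in-apart x∈₁ with find (⋀-free apart x∈₁)
  ... | _ , ψ∈ , x∈ψ with ∈-map⁻ (λ (y , y′) → dist> {σ} y y′ (2 * r)) ψ∈ | x∈ψ
  ... | _ , p∈ , refl | here refl         = x∉ys (proj₁ (∈-pairs ys p∈))
  ... | _ , p∈ , refl | there (here refl) = x∉ys (proj₂ (∈-pairs ys p∈))

  in-φ : x ∉ free (⋀ (List.map (λ y → rename (id [ x₁ ↦ y ]) φ) ys))
  in-φ x∈₂ with find (⋀-free (List.map (λ y → rename (id [ x₁ ↦ y ]) φ) ys) x∈₂)
  ... | _ , ψ∈ , x∈ψ with ∈-map⁻ (λ y → rename (id [ x₁ ↦ y ]) φ) ψ∈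
  ... | y , y∈ys , refl with rename-free φ x∈ψ
  ... | _ , z∈φ , refl with φ-free z∈φ
  ... | here refl = x∉ys y∈ys

-- Here `n` is `k − t`: twice this radius is the distance `(4t+2)R′` demanded of `n + 1` points.
scatterRadius : (q k d n : ℕ) → ℕ
scatterRadius q k d n = suc (2 * (k ∸ n)) * r₁ q (suc k) d

-- Boolean combinations of basic local sentences; m is a strict bound on their
-- inner quantifier rank.
data Sentence (σ : Signature) (d : ℕ) : (q k m : ℕ) → Set where
  true  : Sentence σ d q k m
  not   : Sentence σ d q k m → Sentence σ d q k m
  _∧_   : Sentence σ d q k m → Sentence σ d q k m → Sentence σ d q k m
  lower : m ≤ m′ → Sentence σ d q (suc k) m → Sentence σ d (suc q) k m′
  basic : n ≤ k → Bounded σ d q (suc k) m (x₁ ∷ []) → Sentence σ d (suc q) k (suc m)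

⟦_⟧ˢ : Sentence σ d q k m → Formula σ
⟦ true ⟧ˢ      = true
⟦ not s ⟧ˢ     = not ⟦ s ⟧ˢ
⟦ s ∧ s′ ⟧ˢ    = ⟦ s ⟧ˢ ∧ ⟦ s′ ⟧ˢ
⟦ lower _ s ⟧ˢ = ⟦ s ⟧ˢ
⟦_⟧ˢ {d = d} {k = k} (basic {n = n} {q = q} _ l) =
  scattered (upTo (suc n)) (scatterRadius q k d n) ⟦ l ⟧

sentence-closed : (s : Sentence σ d q k m) → x ∉ free ⟦ s ⟧ˢ
sentence-closed (not s)     x∈ = sentence-closed s x∈
sentence-closed (s ∧ s′)    x∈ =
  Sum.[ sentence-closed s , sentence-closed s′ ]′ (∈-++⁻ (free ⟦ s ⟧ˢ) x∈)
sentence-closed (lower _ s) x∈ = sentence-closed s x∈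
sentence-closed {d = d} {k = k} (basic {n = n} {q = q} _ l) x∈ =
  scattered-closed (upTo (suc n)) (scatterRadius q k d n) ⟦ l ⟧ (⟦⟧-free l) x∈

sentenceConnectives : (σ : Signature) (d q k m : ℕ) → Connectives σ
sentenceConnectives σ d q k m = record
  { Term    = Sentence σ d q k m
  ; formula = ⟦_⟧ˢ
  ; ⊤ᵗ      = true
  ; ¬ᵗ      = not
  ; _∧ᵗ_    = _∧_
  ; sat-⊤   = λ _ → tt
  ; sat-¬   = λ _ _ → ⇔-id _
  ; sat-∧   = λ _ _ _ → ⇔-id _
  }

module NF {σ d q k m X} =
  Mixed (sentenceConnectives σ d q k m) (boundedConnectives σ d q k m X)

open NF public using () renaming (_,_⊩_ to _,_⊩ⁿ_)

NormalForm : (σ : Signature) (d q k m : ℕ) (X : List Var) → Set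
NormalForm σ d q k m X = NF.Mix {σ} {d} {q} {k} {m} {X}

infixr 5 _∨ᵇ_
_∨ᵇ_ : Bounded σ d q k m X → Bounded σ d q k m X → Bounded σ d q k m X
l ∨ᵇ l′ = not (not l ∧ not l′)

⋀ᵇ ⋁ᵇ : List (Bounded σ d q k m X) → Bounded σ d q k m X
⋀ᵇ = List.foldr _∧_ true
⋁ᵇ = List.foldr _∨ᵇ_ (not true)

module _ (𝔸 : Structure σ) {α : Var → Carrier 𝔸} where

  ⋀ᵇ-sat : (ls : List (Bounded σ d q k m X)) →
           (𝔸 , α ⊨ ⟦ ⋀ᵇ ls ⟧) ⇔ All (λ l → 𝔸 , α ⊨ ⟦ l ⟧) ls
  ⋀ᵇ-sat []       = mk⇔ (λ _ → []) (λ _ → tt)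
  ⋀ᵇ-sat (l ∷ ls) = mk⇔ (λ (h , hs) → h ∷ to (⋀ᵇ-sat ls) hs)
                        (λ { (h ∷ hs) → h , from (⋀ᵇ-sat ls) hs })

  ∨ᵇ-sat : (l l′ : Bounded σ d q k m X) →
           (𝔸 , α ⊨ ⟦ l ∨ᵇ l′ ⟧) ⇔ ((𝔸 , α ⊨ ⟦ l ⟧) ⊎ (𝔸 , α ⊨ ⟦ l′ ⟧))
  ∨ᵇ-sat l l′ = mk⇔ forth λ { (inj₁ h) (¬h , _) → ¬h h ; (inj₂ h) (_ , ¬h) → ¬h h }
    where
    forth : _ → (𝔸 , α ⊨ ⟦ l ⟧) ⊎ (𝔸 , α ⊨ ⟦ l′ ⟧)
    forth h with sat? 𝔸 α ⟦ l ⟧ | sat? 𝔸 α ⟦ l′ ⟧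
    ... | yes hl | _      = inj₁ hl
    ... | no ¬hl | yes h′ = inj₂ h′
    ... | no ¬hl | no ¬h′ = contradiction (¬hl , ¬h′) h

  ⋁ᵇ-sat : (ls : List (Bounded σ d q k m X)) →
           (𝔸 , α ⊨ ⟦ ⋁ᵇ ls ⟧) ⇔ Any (λ l → 𝔸 , α ⊨ ⟦ l ⟧) ls
  ⋁ᵇ-sat []       = mk⇔ (λ h → contradiction tt h) (λ ())
  ⋁ᵇ-sat (l ∷ ls) = mk⇔ Any.fromSum Any.toSum ⇔-∘ ((⇔-id _ ⊎-⇔ ⋁ᵇ-sat ls) ⇔-∘ ∨ᵇ-sat l (⋁ᵇ ls))

-- Membership proofs are kept, since the constructors of `Bounded` ask for one with every variable.
allMembers : (xs : List A) → List (∃ (_∈ xs))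
allMembers []       = []
allMembers (x ∷ xs) = (x , here refl) ∷ map (Product.map₂ there) (allMembers xs)

∈-allMembers : {x : A} {xs : List A} (x∈ : x ∈ xs) → (x , x∈) ∈ allMembers xs
∈-allMembers (here refl) = here refl
∈-allMembers (there x∈)  = there (∈-map⁺ (Product.map₂ there) (∈-allMembers x∈))

-- Words, choices and the pigeonhole principle

words : List A → ℕ → List (List A)
words xs zero    = [] ∷ []
words xs (suc n) = cartesianProductWith _∷_ xs (words xs n)

∈-words⁺ : {xs : List A} {w : List A} → All (_∈ xs) w → w ∈ words xs (length w)
∈-words⁺ []       = here refl
∈-words⁺ (x∈ ∷ w) = ∈-cartesianProductWith⁺ _∷_ x∈ (∈-words⁺ w)

∈-words⁻ : (xs : List A) {w : List A} → ∀ n → w ∈ words xs n → length w ≡ n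
∈-words⁻ xs zero    (here refl) = refl
∈-words⁻ xs (suc n) w∈ with ∈-cartesianProductWith⁻ _∷_ xs (words xs n) w∈
... | _ , _ , _ , w′∈ , refl = cong suc (∈-words⁻ xs n w′∈)

module _ {D : A → B → Set} where

  choose : {bs : List B} → All (λ b → ∃[ a ] D a b) bs → ∃[ as ] Pointwise D as bs
  choose []             = [] , []
  choose ((a , δ) ∷ hs) = let as , δs = choose hs in a ∷ as , δ ∷ δs

  pointwise-All : {P : B → Set} {as : List A} {bs : List B} →
                  Pointwise D as bs → All P bs → All (λ a → ∃[ b ] (D a b × P b)) as
  pointwise-All []       []       = []
  pointwise-All (δ ∷ δs) (h ∷ hs) = (_ , δ , h) ∷ pointwise-All δs hs

  -- Transfers distances both from scattered points to the variables near them and from variables to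
  -- the points near them.
  pointwise-AllPairs : {F : B → B → Set} {G : A → A → Set} {as : List A} {bs : List B} →
    (∀ {a a′ b b′} → D a b → D a′ b′ → F b b′ → G a a′) →
    Pointwise D as bs → AllPairs F bs → AllPairs G as
  pointwise-AllPairs F⇒G []       []       = []
  pointwise-AllPairs F⇒G (δ ∷ δs) (h ∷ hs) =
    All.map (λ (_ , δ′ , f) → F⇒G δ δ′ f) (pointwise-All δs h) ∷ pointwise-AllPairs F⇒G δs hs

allPairs-lookup : {R : A → A → Set} {xs : List A} → AllPairs R xs → ∀ {i j} → i Fin.< j →
                  R (List.lookup xs i) (List.lookup xs j)
allPairs-lookup {xs = x ∷ xs} (h ∷ _)  {Fin.zero}  {Fin.suc j} _   = All.lookup h (∈-lookup j)
allPairs-lookup {xs = x ∷ xs} (_ ∷ hs) {Fin.suc i} {Fin.suc j} i<j = allPairs-lookup hs (s≤s⁻¹ i<j)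

length-distinct-< : {xs : List ℕ} → All (_< k) xs → AllPairs _≢_ xs → length xs ≤ k
length-distinct-< {k} {xs} xs<k distinct = ℕ.≮⇒≥ λ k<length →
  let i , j , i<j , eq = Fin.pigeonhole k<length index
  in allPairs-lookup distinct i<j (Fin.fromℕ<-injective _ _ _ _ eq)
  where
  index : Fin (length xs) → Fin k
  index i = fromℕ< (All.lookup xs<k (∈-lookup {xs = xs} i))

-- Eliminating an unbounded quantifier

fromMembers : {xs ys : List A} → All (_∈ xs) ys → ∃[ ws ] map {A = ∃ (_∈ xs)} proj₁ ws ≡ ys
fromMembers []        = [] , refl
fromMembers (y∈ ∷ hs) = let ws , eq = fromMembers hs in (_ , y∈) ∷ ws , cong (_ ∷_) eq

r₁-double : ∀ q → 0 < k → 2 * r₁ q (suc k) d ≤ r₁ (suc q) k d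
r₁-double {suc k} q _ = ℕ.*-monoˡ-≤ _ (ℕ.≤-trans (s≤s (s≤s z≤n)) (ℕ.m≤m*n 4 (suc k)))

r₁-room : ∀ q → 0 < k → r₁ q (suc k) d ≤ r₁ (suc q) k d ∸ r₁ q (suc k) d
r₁-room {k} {d} q 0<k = ℕ.m+n≤o⇒m≤o∸n r
  (subst (λ s → r + s ≤ r₁ (suc q) k d) (ℕ.+-identityʳ r) (r₁-double q 0<k))
  where r = r₁ q (suc k) d

-- With `t = k ∸ n`, this asks for `c` variables pairwise further apart than `4tR′`, each with a
-- `b`-point within `R′`, as a disjunction over all words of variables. Words with repetitions are
-- harmless, as no variable is apart from itself, and the distance atoms are admissible because
-- `4tR′ ≤ 4kR′ = R`.
clusters : (n≤k : n ≤ k) → All (_< k) X → (c : ℕ) →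
           Bounded σ d q (suc k) m (k ∷ []) → Bounded σ d (suc q) k (suc m) X
clusters {n} {k} {X} {d = d} {q} n≤k X<k c b =
  ⋁ᵇ (map (λ vs → ⋀ᵇ (map witnessed vs ++ map apart (pairs vs))) (words (allMembers X) c))
  where
  witnessed : ∃ (_∈ X) → _
  -- `b` speaks about the witness alone; for this `near` allows a body over any `Y ⊆ k ∷ X`.
  witnessed (_ , x∈) = near x∈ (r₁-room q (∈-positive X<k x∈)) (λ { (here refl) → here refl }) b
  apart : ∃ (_∈ X) × ∃ (_∈ X) → _
  apart ((_ , x∈) , (_ , y∈)) =
    not (dist x∈ y∈ (ℕ.*-monoˡ-≤ (r₁ q (suc k) d) (ℕ.*-monoʳ-≤ 4 (ℕ.m∸n≤m k n))))

-- There are `n + 1` scattered points but no `n + 1` clusters, so some scattered point lies in no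
-- ball of radius `R′` around `X`.
farCase : {k : ℕ} {X : List Var} → All (_< k) X → Bounded σ d q (suc k) m (k ∷ []) →
          ∀ n → n ≤ k → Sentence σ d (suc q) k (suc m) × Bounded σ d (suc q) k (suc m) X
farCase {k = k} X<k b n n≤k =
  -- The inner formula of a basic local sentence has the free variable `x₁`, whereas `b` has `k`.
  basic n≤k (substitute (const x₁) (λ _ → here refl) b) , not (clusters n≤k X<k (suc n) b)

indexedFarCase : {k : ℕ} {X : List Var} → All (_< k) X → Bounded σ d q (suc k) m (k ∷ []) →
                 Fin (suc k) → Sentence σ d (suc q) k (suc m) × Bounded σ d (suc q) k (suc m) X
indexedFarCase X<k b i = farCase X<k b (toℕ i) (s≤s⁻¹ (Fin.toℕ<n i))

-- If b holds somewhere outside the balls of radius R − R′ around X, then one of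
-- these cases holds; if one of them holds, then b holds somewhere outside the
-- balls of radius R′ around X.  Here R = 4kR′ = r₁ (suc q) k d.
farPoint : All (_< k) X → Bounded σ d q (suc k) m (k ∷ []) → NormalForm σ d (suc q) k (suc m) X
farPoint X<k b = List.tabulate (indexedFarCase X<k b)

elimSplit : Splits (k ∷ X) X (k ∷ [])
elimSplit (here refl) = inj₂ (here refl)
elimSplit (there x∈)  = inj₁ x∈

module _ {σ d q k m X} (X<k : All (_< k) X) (l : Bounded σ d q (suc k) m (k ∷ X)) where

  nearCases farCases : NormalForm σ d (suc q) k (suc m) X
  nearCases = map (λ (_ , x∈) → true , near x∈ ℕ.≤-refl id l) (allMembers X)
  farCases  = concatMap (λ (a , b) → NF.right (lower (ℕ.n≤1+n m) a) NF.∧ᵐ farPoint X<k b)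
                        (separate elimSplit l)

  eliminate : NormalForm σ d (suc q) k (suc m) X
  eliminate = nearCases ++ farCases

module _ (𝔸 : Structure σ) {d q k m : ℕ} {X : List Var} (X<k : All (_< k) X)
         (b : Bounded σ d q (suc k) m (k ∷ [])) (α : Var → Carrier 𝔸) where
  private
    r = r₁ q (suc k) d

    P : Carrier 𝔸 → Set
    P p = 𝔸 , const p ⊨ ⟦ b ⟧

  P-update : ∀ {p} → (𝔸 , α [ k ↦ p ] ⊨ ⟦ b ⟧) ⇔ P p
  P-update {p} = coincidence 𝔸 ⟦ b ⟧ (agree ∘ ⟦⟧-free b)
    where
    agree : ∀ {x} → x ∈ k ∷ [] → (α [ k ↦ p ]) x ≡ p
    agree (here refl) = update-same α k

  P-substitute : ∀ {p} → (𝔸 , const p ⊨ ⟦ substitute (const x₁) (λ _ → here refl) b ⟧) ⇔ P p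
  P-substitute = substitute-sat 𝔸 (const x₁) _ b (ℕ.≤-refl ∷ []) (s≤s z≤n ∷ []) λ _ → refl

  Clusters : (s c : ℕ) → Set
  Clusters s c = ∃[ vs ] (length vs ≡ c ×
    All (λ v → v ∈ X × (∃[ p ] (Dist≤ 𝔸 (α v) p r × P p))) vs ×
    AllPairs (λ v w → ¬ Dist≤ 𝔸 (α v) (α w) s) vs)

  clusters-sat : (n≤k : n ≤ k) → ∀ c →
                 (𝔸 , α ⊨ ⟦ clusters n≤k X<k c b ⟧) ⇔ Clusters (4 * (k ∸ n) * r) c
  clusters-sat {n} n≤k c = mk⇔ forth back ⇔-∘ (mk⇔ Any.map⁻ Any.map⁺ ⇔-∘ ⋁ᵇ-sat 𝔸 _)
    where
    forth : Any _ (words (allMembers X) c) → Clusters (4 * (k ∸ n) * r) c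
    forth h with find h
    ... | vs , vs∈ , h′ with to (⋀ᵇ-sat 𝔸 _) h′
    ... | hs = map proj₁ vs , trans (List.length-map proj₁ vs) (∈-words⁻ (allMembers X) c vs∈) ,
      All.map⁺ (All.map (λ {v} hv → proj₂ v ,
          let p , δ , hp = to (near-sat 𝔸 ⟦ b ⟧ (proj₂ v) X<k) hv in p , δ , to P-update hp)
        (All.map⁻ (All.++⁻ˡ _ hs))) ,
      AllPairs.map⁺ (to (pairs-All vs) (All.map⁻ (All.++⁻ʳ (map _ vs) hs)))
    back : Clusters (4 * (k ∸ n) * r) c → Any _ (words (allMembers X) c)
    back (vs , len , hs , far) with fromMembers (All.map proj₁ hs)
    ... | ws , refl = lose
      (subst (λ c → ws ∈ words (allMembers X) c) (trans (sym (List.length-map proj₁ ws)) len)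
        (∈-words⁺ (All.universal (∈-allMembers ∘ proj₂) ws)))
      (from (⋀ᵇ-sat 𝔸 _) (All.++⁺
        (All.map⁺ (All.map (λ {v} (_ , p , δ , hp) →
          from (near-sat 𝔸 ⟦ b ⟧ (proj₂ v) X<k) (p , δ , from P-update hp)) (All.map⁻ hs)))
        (All.map⁺ (from (pairs-All ws) (AllPairs.map⁻ far)))))

  farCase-sat : ∀ n (n≤k : n ≤ k) →
    NF.Holds 𝔸 α (farCase X<k b n n≤k) ⇔
    (Scattered 𝔸 P (scatterRadius q k d n) (suc n) × (¬ Clusters (4 * (k ∸ n) * r) (suc n)))
  farCase-sat n n≤k =
    (scattered-⇔ ⇔-∘ scattered-sat 𝔸 (suc n) (scatterRadius q k d n) _ (⟦⟧-free b₁))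
    ×-⇔ ¬-cong-⇔ (clusters-sat n≤k (suc n))
    where
    b₁ = substitute (const x₁) (λ _ → here refl) b
    scattered-⇔ : Scattered 𝔸 (λ p → 𝔸 , const p ⊨ ⟦ b₁ ⟧) (scatterRadius q k d n) (suc n) ⇔
                  Scattered 𝔸 P (scatterRadius q k d n) (suc n)
    scattered-⇔ = mk⇔
      (λ (ps , len , hs , far) → ps , len , All.map (to P-substitute) hs , far)
      (λ (ps , len , hs , far) → ps , len , All.map (from P-substitute) hs , far)

  close? : ∀ p → Dec (Any (λ x → Dist≤ 𝔸 (α x) p r) X)
  close? p = Any.any? (λ x → dist≤? 𝔸 (α x) p r) X

  farPoint-sound : (𝔸 , α ⊩ⁿ farPoint X<k b) →
                   ∃[ p ] (P p × (∀ {x} → x ∈ X → ¬ Dist≤ 𝔸 (α x) p r))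
  farPoint-sound h with i , hᵢ ← Any.tabulate⁻ {f = indexedFarCase X<k b} h
    with (ps , len , hs , far) , few ← to (farCase-sat (toℕ i) (s≤s⁻¹ (Fin.toℕ<n i))) hᵢ
    with All.all? close? ps
  ... | no ¬close with p , p∈ , p-far ← find (All.¬All⇒Any¬ close? ps ¬close) =
    p , All.lookup hs p∈ , λ x∈ δ → p-far (lose x∈ δ)
  ... | yes close with vs , δs ← choose (All.map find close) = contradiction
    ( vs , trans (Pointwise-length δs) len
    , All.map (λ (p , (v∈ , δ) , hp) → v∈ , p , δ , hp) (pointwise-All δs hs)
    , pointwise-AllPairs
        (λ (_ , δ) (_ , δ′) ¬close close → ¬close (subst (Dist≤ 𝔸 _ _) (radii (k ∸ toℕ i) r)
          (dist-trans 𝔸 (dist-trans 𝔸 (dist-sym 𝔸 δ) close) δ′))) δs far) few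
    where
    radii : ∀ t r → r + 4 * t * r + r ≡ 2 * (suc (2 * t) * r)
    radii = solve 2 (λ t r → r :+ con 4 :* t :* r :+ r :=
                             con 2 :* ((con 1 :+ con 2 :* t) :* r)) refl
      where open +-*-Solver

  -- The search for a threshold starts at distance 0, where the centres merely have different values
  -- and so are different variables below `k`.
  no-clusters : ¬ Clusters 0 (suc k)
  no-clusters (vs , len , hs , far) = ℕ.<-irrefl refl (subst (_≤ k) len
    (length-distinct-< (All.map (λ (v∈ , _) → All.lookup X<k v∈) hs)
      (AllPairs.map (λ { ¬close refl → ¬close (dist-refl 𝔸) }) far)))

  -- Downward search on `n` from `k`, with the invariant that there are no `n + 1` clusters at
  -- distance `4(k−n)R′`. If the next larger threshold still admits `n` clusters, their points
  -- together with `y` give case `n`; otherwise the invariant passes to `n − 1`.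
  farPoint-complete : ∀ {y} → P y →
    (∀ {x} → x ∈ X → ¬ Dist≤ 𝔸 (α x) y (r₁ (suc q) k d ∸ r)) → 𝔸 , α ⊩ⁿ farPoint X<k b
  farPoint-complete {y} Py far = case k ℕ.≤-refl
    (subst (λ t → ¬ Clusters (4 * t * r) (suc k)) (sym (ℕ.n∸n≡0 k)) no-clusters)
    where
    Case : ℕ → Set
    Case n = Scattered 𝔸 P (scatterRadius q k d n) (suc n) × (¬ Clusters (4 * (k ∸ n) * r) (suc n))

    found : ∀ n → n ≤ k → Case n → 𝔸 , α ⊩ⁿ farPoint X<k b
    found n n≤k h = Any.tabulate⁺ {f = indexedFarCase X<k b} i
      (from (farCase-sat (toℕ i) (s≤s⁻¹ (Fin.toℕ<n i)))
        (subst Case (sym (Fin.toℕ-fromℕ< (s≤s n≤k))) h))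
      where i = fromℕ< (s≤s n≤k)

    case : ∀ n → n ≤ k → ¬ Clusters (4 * (k ∸ n) * r) (suc n) → 𝔸 , α ⊩ⁿ farPoint X<k b
    -- A single point is subject to no distance condition, so `y` alone suffices.
    case zero    _   few = found 0 z≤n ((y ∷ [] , refl , Py ∷ [] , [] ∷ []) , few)
    case (suc n) n<k few with sat? 𝔸 α ⟦ clusters (ℕ.<⇒≤ n<k) X<k (suc n) b ⟧
    ... | no ¬h = case n (ℕ.<⇒≤ n<k) (¬h ∘ from (clusters-sat (ℕ.<⇒≤ n<k) (suc n)))
    ... | yes h = found (suc n) n<k (scatter (to (clusters-sat (ℕ.<⇒≤ n<k) (suc n)) h) , few)
      where
      t = k ∸ suc n

      k∸n≡ : k ∸ n ≡ suc t
      k∸n≡ = ℕ.+-∸-assoc 1 n<k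

      radii : ∀ t r → r + 2 * (suc (2 * t) * r) + r ≡ 4 * suc t * r
      radii = solve 2 (λ t r → r :+ con 2 :* ((con 1 :+ con 2 :* t) :* r) :+ r :=
                               con 4 :* (con 1 :+ t) :* r) refl
        where open +-*-Solver

      scatter : Clusters (4 * (k ∸ n) * r) (suc n) →
                Scattered 𝔸 P (scatterRadius q k d (suc n)) (suc (suc n))
      scatter (vs , len , hs , apart) with ps , δs ← choose (All.map proj₂ hs) = y ∷ ps ,
        cong suc (trans (Pointwise-length δs) len) ,
        Py ∷ All.map (λ (_ , (_ , hp) , _) → hp) points ,
        All.map (λ (v , (δ , _) , v∈ , _) close → far v∈
          (dist-mono 𝔸 (ℕ.m+n≤o⇒m≤o∸n _ within) (dist-trans 𝔸 δ (dist-sym 𝔸 close)))) points ∷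
        pointwise-AllPairs (λ (δ , _) (δ′ , _) ¬close close → ¬close
          (subst (Dist≤ 𝔸 _ _) (trans (radii t r) (cong (λ s → 4 * s * r) (sym k∸n≡)))
            (dist-trans 𝔸 (dist-trans 𝔸 δ close) (dist-sym 𝔸 δ′)))) δs apart
        where
        points = pointwise-All δs hs
        -- Since `t + 1 ≤ k`, what remains of `R = 4kR′` after deducting `R′` twice is at least
        -- `(4t+2)R′`, the distance required between `y` and a point near `x̄`.
        within : r + 2 * (suc (2 * t) * r) + r ≤ r₁ (suc q) k d
        within = subst (_≤ r₁ (suc q) k d) (sym (radii t r))
          (ℕ.*-monoˡ-≤ r (ℕ.*-monoʳ-≤ 4 (subst (_≤ k) k∸n≡ (ℕ.m∸n≤m k n))))

module _ (𝔸 : Structure σ) {d q k m : ℕ} {X : List Var} (X<k : All (_< k) X)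
         (l : Bounded σ d q (suc k) m (k ∷ X)) {α : Var → Carrier 𝔸} where
  private
    R  = r₁ (suc q) k d
    R′ = r₁ q (suc k) d

  NearWitness FarWitness : Set
  NearWitness = Any (λ x → ∃[ p ] (Dist≤ 𝔸 (α x) p (R ∸ R′) × (𝔸 , α [ k ↦ p ] ⊨ ⟦ l ⟧))) X
  FarWitness  = Any (λ (a , b) → (𝔸 , α ⊨ ⟦ a ⟧) × (𝔸 , α ⊩ⁿ farPoint X<k b)) (separate elimSplit l)

  nearCases-sat : (𝔸 , α ⊩ⁿ nearCases X<k l) ⇔ NearWitness
  nearCases-sat = mk⇔ forth back
    where
    forth : 𝔸 , α ⊩ⁿ nearCases X<k l → NearWitness
    forth h with (_ , x∈) , _ , (_ , h′) ← find (Any.map⁻ h) =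
      lose x∈ (to (near-sat 𝔸 ⟦ l ⟧ x∈ X<k) h′)
    back : NearWitness → 𝔸 , α ⊩ⁿ nearCases X<k l
    back h with x , x∈ , h′ ← find h =
      Any.map⁺ (lose (∈-allMembers x∈) (tt , from (near-sat 𝔸 ⟦ l ⟧ x∈ X<k) h′))

  farCases-sat : (𝔸 , α ⊩ⁿ farCases X<k l) ⇔ FarWitness
  farCases-sat = mk⇔
    (λ h → Any.map (λ {(a , b)} h′ → let ha , hb = to (NF.∧ᵐ-sat 𝔸 (NF.right _) (farPoint X<k b)) h′
                                     in to (NF.right-sat 𝔸 _) ha , hb)
             (Any.concatMap⁻ _ h))
    (λ h → Any.concatMap⁺ _ (Any.map (λ {(a , b)} (ha , hb) →
             from (NF.∧ᵐ-sat 𝔸 (NF.right _) (farPoint X<k b)) (from (NF.right-sat 𝔸 _) ha , hb)) h))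

  separate-at : ∀ {p} → (∀ {x} → x ∈ X → ¬ Dist≤ 𝔸 (α x) p R′) →
    (𝔸 , α [ k ↦ p ] ⊩ separate elimSplit l) ⇔ (𝔸 , α [ k ↦ p ] ⊨ ⟦ l ⟧)
  separate-at {p} far = separate-sat 𝔸 elimSplit l
    (ℕ.≤-refl ∷ All-<-suc X<k) (All-<-suc X<k) (ℕ.≤-refl ∷ []) far′
    where
    far′ : Far 𝔸 X (k ∷ []) (α [ k ↦ p ]) R′
    far′ x∈ (here refl)
      rewrite update-same α k {p} | update-other α {a = p} (ℕ.<⇒≢ (All.lookup X<k x∈)) =
      far x∈

  eliminate-sat : (𝔸 , α ⊩ⁿ eliminate X<k l) ⇔ (∃[ p ] (𝔸 , α [ k ↦ p ] ⊨ ⟦ l ⟧))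
  eliminate-sat = mk⇔ forth back ⇔-∘ ((nearCases-sat ⊎-⇔ farCases-sat)
                  ⇔-∘ NF.++-sat 𝔸 (nearCases X<k l) (farCases X<k l))
    where
    forth : NearWitness ⊎ FarWitness → ∃[ p ] (𝔸 , α [ k ↦ p ] ⊨ ⟦ l ⟧)
    forth (inj₁ h) with _ , _ , (p , _ , hp) ← find h = p , hp
    forth (inj₂ h) with (a , b) , ab∈ , ha , hb ← find h
      with p , Pp , far ← farPoint-sound 𝔸 X<k b α hb =
      p , to (separate-at far)
            (lose ab∈ (from (⟦⟧-update 𝔸 a X<k) ha , from (P-update 𝔸 X<k b α) Pp))
    back : ∃[ p ] (𝔸 , α [ k ↦ p ] ⊨ ⟦ l ⟧) → NearWitness ⊎ FarWitness
    back (p , hp) with Any.any? (λ x → dist≤? 𝔸 (α x) p (R ∸ R′)) X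
    ... | yes close = inj₁ (Any.map (λ δ → p , δ , hp) close)
    ... | no ¬close = inj₂ (Any.map
      (λ {(a , b)} (ha , hb) → to (⟦⟧-update 𝔸 a X<k) ha ,
        farPoint-complete 𝔸 X<k b α (to (P-update 𝔸 X<k b α) hb) far)
      (from (separate-at λ x∈ → far x∈ ∘ dist-mono 𝔸 (r₁-room q (∈-positive X<k x∈))) hp))
      where
      far : ∀ {x} → x ∈ X → ¬ Dist≤ 𝔸 (α x) p (R ∸ R′)
      far x∈ δ = ¬close (lose x∈ δ)

-- Deciding FO⁺(q,k,d)

mapCombination : ∀ {p p′} {P : Formula σ → Set p} {P′ : Formula σ → Set p′} {φ} →
                 (∀ {χ} → P χ → P′ χ) → BooleanCombination P φ → BooleanCombination P′ φ
mapCombination f (leaf l) = leaf (f l)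
mapCombination f (not c)  = not (mapCombination f c)
mapCombination f (c ∧ c′) = mapCombination f c ∧ mapCombination f c′
mapCombination f (c ∨ c′) = mapCombination f c ∨ mapCombination f c′

allLeaves-map : ∀ {p p′ b} {P : Formula σ → Set p} {P′ : Formula σ → Set p′} {φ}
  {f : ∀ {χ} → P χ → P′ χ} {Q : ∀ {χ} → P′ χ → Set b} →
  (∀ {χ} (l : P χ) → Q (f l)) → (c : BooleanCombination P φ) →
  AllLeaves {P = P′} Q (mapCombination f c)
allLeaves-map q (leaf l) = q l
allLeaves-map {Q = Q} q (not c)  = allLeaves-map {Q = Q} q c
allLeaves-map {Q = Q} q (c ∧ c′) = allLeaves-map {Q = Q} q c , allLeaves-map {Q = Q} q c′
allLeaves-map {Q = Q} q (c ∨ c′) = allLeaves-map {Q = Q} q c , allLeaves-map {Q = Q} q c′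

module _ {p} {P : Formula σ → Set p} (P? : ∀ φ → Dec (P φ)) where

  combination? : ∀ φ → Dec (BooleanCombination P φ)
  combination? φ with P? φ
  ... | yes l = yes (leaf l)
  combination? true          | no ¬l = no λ { (leaf l) → ¬l l }
  combination? false         | no ¬l = no λ { (leaf l) → ¬l l }
  combination? (x ≐ y)       | no ¬l = no λ { (leaf l) → ¬l l }
  combination? (atom R xs)   | no ¬l = no λ { (leaf l) → ¬l l }
  combination? (dist≤ x y n) | no ¬l = no λ { (leaf l) → ¬l l }
  combination? (ex x φ)      | no ¬l = no λ { (leaf l) → ¬l l }
  combination? (not φ)       | no ¬l =
    map′ not (λ { (leaf l) → contradiction l ¬l ; (not c) → c }) (combination? φ)
  combination? (φ ∧ ψ)       | no ¬l =
    map′ (uncurry _∧_) (λ { (leaf l) → contradiction l ¬l ; (c ∧ c′) → c , c′ })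
         (combination? φ ×-dec combination? ψ)
  combination? (φ ∨ ψ)       | no ¬l =
    map′ (uncurry _∨_) (λ { (leaf l) → contradiction l ¬l ; (c ∨ c′) → c , c′ })
         (combination? φ ×-dec combination? ψ)

module _ {Prev : Formula σ → Set} (prev? : ∀ φ → Dec (Prev φ)) (k R R′ : ℕ) where
  private
    Gen : Formula σ → Set
    Gen = Generator Prev k R R′

  exNear? : ∀ x φ → Dec (∃[ i ] ∃[ n ] ∃[ ψ ]
              (φ ≡ dist≤ i x n ∧ ψ × i < k × n ≤ R ∸ R′ × Prev ψ))
  exNear? x (dist≤ i y n ∧ ψ) = map′
    (λ { (refl , i<k , n≤ , p) → i , n , ψ , refl , i<k , n≤ , p })
    (λ { (_ , _ , _ , refl , i<k , n≤ , p) → refl , i<k , n≤ , p })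
    ((y ≟ x) ×-dec (i ℕ.<? k) ×-dec (n ℕ.≤? (R ∸ R′)) ×-dec prev? ψ)
  exNear? x true              = no λ { (_ , _ , _ , () , _) }
  exNear? x false             = no λ { (_ , _ , _ , () , _) }
  exNear? x (_ ≐ _)           = no λ { (_ , _ , _ , () , _) }
  exNear? x (atom _ _)        = no λ { (_ , _ , _ , () , _) }
  exNear? x (dist≤ _ _ _)     = no λ { (_ , _ , _ , () , _) }
  exNear? x (not _)           = no λ { (_ , _ , _ , () , _) }
  exNear? x (_ ∨ _)           = no λ { (_ , _ , _ , () , _) }
  exNear? x (ex _ _)          = no λ { (_ , _ , _ , () , _) }
  exNear? x (true ∧ _)        = no λ { (_ , _ , _ , () , _) }
  exNear? x (false ∧ _)       = no λ { (_ , _ , _ , () , _) }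
  exNear? x ((_ ≐ _) ∧ _)     = no λ { (_ , _ , _ , () , _) }
  exNear? x (atom _ _ ∧ _)    = no λ { (_ , _ , _ , () , _) }
  exNear? x (not _ ∧ _)       = no λ { (_ , _ , _ , () , _) }
  exNear? x ((_ ∧ _) ∧ _)     = no λ { (_ , _ , _ , () , _) }
  exNear? x ((_ ∨ _) ∧ _)     = no λ { (_ , _ , _ , () , _) }
  exNear? x (ex _ _ ∧ _)      = no λ { (_ , _ , _ , () , _) }

  generator? : ∀ φ → Dec (Gen φ)
  generator? φ with prev? φ ×-dec All.all? (ℕ._<? k) (free φ)
  ... | yes (p , free<k) = yes (lower p free<k)
  generator? true        | no ¬l = no λ { (lower p f) → ¬l (p , f) }
  generator? false       | no ¬l = no λ { (lower p f) → ¬l (p , f) }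
  generator? (x ≐ y)     | no ¬l = no λ { (lower p f) → ¬l (p , f) }
  generator? (atom R xs) | no ¬l = no λ { (lower p f) → ¬l (p , f) }
  generator? (not φ)     | no ¬l = no λ { (lower p f) → ¬l (p , f) }
  generator? (φ ∧ ψ)     | no ¬l = no λ { (lower p f) → ¬l (p , f) }
  generator? (φ ∨ ψ)     | no ¬l = no λ { (lower p f) → ¬l (p , f) }
  generator? (dist≤ i j n) | no ¬l =
    map′ (λ (i<k , j<k , n≤) → dist i<k j<k n≤)
         (λ { (lower p f) → contradiction (p , f) ¬l ; (dist i<k j<k n≤) → i<k , j<k , n≤ })
         ((i ℕ.<? k) ×-dec (j ℕ.<? k) ×-dec (n ℕ.≤? R))
  generator? (ex x φ) | no ¬l with x ≟ k
  ... | no x≢k = no λ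
    { (lower p f) → ¬l (p , f) ; (exNear _ _ _) → x≢k refl ; (exAny _) → x≢k refl }
  ... | yes refl = map′
    (λ { (inj₁ (_ , _ , _ , refl , i<k , n≤ , p)) → exNear i<k n≤ p ; (inj₂ p) → exAny p })
    (λ { (lower p f) → contradiction (p , f) ¬l
       ; (exNear i<k n≤ p) → inj₁ (_ , _ , _ , refl , i<k , n≤ , p) ; (exAny p) → inj₂ p })
    (exNear? k φ ⊎-dec prev? φ)

-- The normal form is to be computed from `φ`, `q`, `k` and `d` alone, so the derivation that guides
-- the construction has to be found rather than assumed.
FO⁺? : ∀ q k d (φ : Formula σ) → Dec (FO⁺ q k d φ)
FO⁺? zero    k d φ = (qr φ ≟ 0) ×-dec All.all? (ℕ._<? k) (free φ) ×-dec (md φ ℕ.≤? d)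
FO⁺? (suc q) k d φ = All.all? (ℕ._<? k) (free φ) ×-dec
  combination? (generator? (FO⁺? q (suc k) d) k (r₁ (suc q) k d) (r₁ q (suc k) d)) φ

-- Gaifman normal form

fromQuantifierFree : (φ : Formula σ) → qr φ ≤ 0 → md φ ≤ d → free φ ⊆ X → Bounded σ d 0 k m X
fromQuantifierFree true          _  _  _  = true
fromQuantifierFree false         _  _  _  = not true
fromQuantifierFree (x ≐ y)       _  _  ⊆X = equal (⊆X (here refl)) (⊆X (there (here refl)))
fromQuantifierFree (atom R xs)   _  _  ⊆X = atom R xs ⊆X
fromQuantifierFree (dist≤ x y n) _  n≤ ⊆X = dist (⊆X (here refl)) (⊆X (there (here refl))) n≤
fromQuantifierFree (not φ)       q0 d≤ ⊆X = not (fromQuantifierFree φ q0 d≤ ⊆X)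
fromQuantifierFree (φ ∧ ψ)       q0 d≤ ⊆X =
  fromQuantifierFree φ (ℕ.m⊔n≤o⇒m≤o _ _ q0) (ℕ.m⊔n≤o⇒m≤o _ _ d≤) (⊆X ∘ ∈-++⁺ˡ) ∧
  fromQuantifierFree ψ (ℕ.m⊔n≤o⇒n≤o (qr φ) _ q0) (ℕ.m⊔n≤o⇒n≤o (md φ) _ d≤) (⊆X ∘ ∈-++⁺ʳ (free φ))
fromQuantifierFree (φ ∨ ψ)       q0 d≤ ⊆X =
  fromQuantifierFree φ (ℕ.m⊔n≤o⇒m≤o _ _ q0) (ℕ.m⊔n≤o⇒m≤o _ _ d≤) (⊆X ∘ ∈-++⁺ˡ) ∨ᵇ
  fromQuantifierFree ψ (ℕ.m⊔n≤o⇒n≤o (qr φ) _ q0) (ℕ.m⊔n≤o⇒n≤o (md φ) _ d≤) (⊆X ∘ ∈-++⁺ʳ (free φ))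

fromQuantifierFree-sat : (𝔸 : Structure σ) {α : Var → Carrier 𝔸} (φ : Formula σ)
  (q0 : qr φ ≤ 0) (d≤ : md φ ≤ d) (⊆X : free φ ⊆ X) →
  (𝔸 , α ⊨ ⟦ fromQuantifierFree {k = k} {m = m} φ q0 d≤ ⊆X ⟧) ⇔ (𝔸 , α ⊨ φ)
fromQuantifierFree-sat 𝔸 true          q0 d≤ ⊆X = ⇔-id _
fromQuantifierFree-sat 𝔸 false         q0 d≤ ⊆X = mk⇔ (λ h → contradiction tt h) (λ ())
fromQuantifierFree-sat 𝔸 (x ≐ y)       q0 d≤ ⊆X = ⇔-id _
fromQuantifierFree-sat 𝔸 (atom R xs)   q0 d≤ ⊆X = ⇔-id _
fromQuantifierFree-sat 𝔸 (dist≤ x y n) q0 d≤ ⊆X = ⇔-id _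
fromQuantifierFree-sat 𝔸 (not φ)       q0 d≤ ⊆X = ¬-cong-⇔ (fromQuantifierFree-sat 𝔸 φ q0 d≤ ⊆X)
fromQuantifierFree-sat 𝔸 (φ ∧ ψ)       q0 d≤ ⊆X =
  fromQuantifierFree-sat 𝔸 φ _ _ _ ×-⇔ fromQuantifierFree-sat 𝔸 ψ _ _ _
fromQuantifierFree-sat {k = k} {m = m} 𝔸 (φ ∨ ψ) q0 d≤ ⊆X =
  (fromQuantifierFree-sat 𝔸 φ _ _ _ ⊎-⇔ fromQuantifierFree-sat 𝔸 ψ _ _ _)
  ⇔-∘ ∨ᵇ-sat 𝔸
        (fromQuantifierFree {k = k} {m = m} φ _ (ℕ.m⊔n≤o⇒m≤o _ _ d≤) (⊆X ∘ ∈-++⁺ˡ))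
        (fromQuantifierFree ψ (ℕ.m⊔n≤o⇒n≤o (qr φ) _ q0) (ℕ.m⊔n≤o⇒n≤o (md φ) _ d≤)
          (⊆X ∘ ∈-++⁺ʳ (free φ)))

GeneratorOf : (σ : Signature) (d q k : ℕ) → Formula σ → Set
GeneratorOf σ d q k = Generator (FO⁺ q (suc k) d) k (r₁ (suc q) k d) (r₁ q (suc k) d)

free-body : (φ : Formula σ) → free (ex k φ) ⊆ X → free φ ⊆ k ∷ X
free-body {k = k} φ ⊆X {x} x∈ with x ≟ k
... | yes refl = here refl
... | no x≢k   = there (⊆X (∈-filter⁺ (λ y → ¬? (y ≟ k)) x∈ x≢k))

exNear-∈ : ∀ {i n} (ψ : Formula σ) → i < k → free (ex k (dist≤ i k n ∧ ψ)) ⊆ X → i ∈ X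
exNear-∈ {k = k} ψ i<k ⊆X = ⊆X (∈-filter⁺ (λ y → ¬? (y ≟ k)) (here refl) (ℕ.<⇒≢ i<k))

exNear-body : ∀ {i n} (ψ : Formula σ) → free (ex k (dist≤ i k n ∧ ψ)) ⊆ X → free ψ ⊆ k ∷ X
exNear-body {k = k} {i = i} {n} ψ ⊆X = λ x∈ → free-body (dist≤ i k n ∧ ψ) ⊆X (there (there x∈))

mutual
  -- `X` and `m` are independent of `k` and `q` because free variables and ranks are to be bounded
  -- by those of `φ` itself, not by those its class permits.
  normalise : ∀ q (φ : Formula σ) → FO⁺ q k d φ → All (_< k) X → free φ ⊆ X → qr φ ≤ m →
              NormalForm σ d q k m X
  normalise zero    φ (q0 , _ , d≤) X<k ⊆X qr≤ =
    NF.right (fromQuantifierFree φ (ℕ.≤-reflexive q0) d≤ ⊆X)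
  normalise (suc q) φ (_ , c) X<k ⊆X qr≤ = normaliseCombination c X<k ⊆X qr≤

  normaliseCombination : {φ : Formula σ} → BooleanCombination (GeneratorOf σ d q k) φ →
    All (_< k) X → free φ ⊆ X → qr φ ≤ m → NormalForm σ d (suc q) k m X
  normaliseCombination (leaf g)  X<k ⊆X qr≤ = normaliseGenerator g X<k ⊆X qr≤
  normaliseCombination (not c)   X<k ⊆X qr≤ = NF.¬ᵐ (normaliseCombination c X<k ⊆X qr≤)
  normaliseCombination (_∧_ {φ = φ} {ψ = ψ} c c′) X<k ⊆X qr≤ =
    normaliseCombination c  X<k (⊆X ∘ ∈-++⁺ˡ)          (ℕ.m⊔n≤o⇒m≤o (qr φ) _ qr≤) NF.∧ᵐ
    normaliseCombination c′ X<k (⊆X ∘ ∈-++⁺ʳ (free φ)) (ℕ.m⊔n≤o⇒n≤o (qr φ) _ qr≤)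
  normaliseCombination (_∨_ {φ = φ} {ψ = ψ} c c′) X<k ⊆X qr≤ =
    normaliseCombination c  X<k (⊆X ∘ ∈-++⁺ˡ)          (ℕ.m⊔n≤o⇒m≤o (qr φ) _ qr≤) ++
    normaliseCombination c′ X<k (⊆X ∘ ∈-++⁺ʳ (free φ)) (ℕ.m⊔n≤o⇒n≤o (qr φ) _ qr≤)

  normaliseGenerator : {φ : Formula σ} → GeneratorOf σ d q k φ →
    All (_< k) X → free φ ⊆ X → qr φ ≤ m → NormalForm σ d (suc q) k m X
  normaliseGenerator {φ = φ} (lower p _) X<k ⊆X qr≤ =
    map (Product.map (lower ℕ.≤-refl) (lower ℕ.≤-refl)) (normalise _ φ p (All-<-suc X<k) ⊆X qr≤)
  normaliseGenerator (dist _ _ n≤) X<k ⊆X qr≤ =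
    NF.right (dist (⊆X (here refl)) (⊆X (there (here refl))) n≤)
  normaliseGenerator (exNear {i} {n} {ψ} i<k n≤ p) X<k ⊆X (s≤s qr≤) =
    map (Product.map (lower (ℕ.n≤1+n _)) (near (exNear-∈ {n = n} ψ i<k ⊆X) n≤ id))
      (normalise _ ψ p (ℕ.≤-refl ∷ All-<-suc X<k) (exNear-body {i = i} {n} ψ ⊆X) qr≤)
  normaliseGenerator (exAny {ψ} p) X<k ⊆X (s≤s qr≤) =
    -- The sentence `s` is closed and stays outside the quantifier; only `l` is left to eliminate.
    concatMap (λ (s , l) → NF.left (lower (ℕ.n≤1+n _) s) NF.∧ᵐ eliminate X<k l)
      (normalise _ ψ p (ℕ.≤-refl ∷ All-<-suc X<k) (free-body ψ ⊆X) qr≤)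

module _ (𝔸 : Structure σ) where

  sentence-sat : ∀ {α β} (s : Sentence σ d q k m) → (𝔸 , α ⊨ ⟦ s ⟧ˢ) ⇔ (𝔸 , β ⊨ ⟦ s ⟧ˢ)
  sentence-sat s = coincidence 𝔸 ⟦ s ⟧ˢ λ x∈ → contradiction x∈ (sentence-closed s)

  mutual
    normalise-sat : ∀ q {α} (φ : Formula σ) (p : FO⁺ q k d φ) (X<k : All (_< k) X) (⊆X : free φ ⊆ X)
      (qr≤ : qr φ ≤ m) → (𝔸 , α ⊩ⁿ normalise q φ p X<k ⊆X qr≤) ⇔ (𝔸 , α ⊨ φ)
    normalise-sat zero    φ (q0 , _ , d≤) X<k ⊆X qr≤ =
      fromQuantifierFree-sat 𝔸 φ (ℕ.≤-reflexive q0) d≤ ⊆X ⇔-∘ NF.right-sat 𝔸 _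
    normalise-sat (suc q) φ (_ , c) X<k ⊆X qr≤ = normaliseCombination-sat c X<k ⊆X qr≤

    normaliseCombination-sat : ∀ {α} {φ : Formula σ}
      (c : BooleanCombination (GeneratorOf σ d q k) φ)
      (X<k : All (_< k) X) (⊆X : free φ ⊆ X) (qr≤ : qr φ ≤ m) →
      (𝔸 , α ⊩ⁿ normaliseCombination c X<k ⊆X qr≤) ⇔ (𝔸 , α ⊨ φ)
    normaliseCombination-sat (leaf g) X<k ⊆X qr≤ = normaliseGenerator-sat g X<k ⊆X qr≤
    normaliseCombination-sat (not c)  X<k ⊆X qr≤ =
      ¬-cong-⇔ (normaliseCombination-sat c X<k ⊆X qr≤)
      ⇔-∘ NF.¬ᵐ-sat 𝔸 (normaliseCombination c X<k ⊆X qr≤)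
    normaliseCombination-sat (c ∧ c′) X<k ⊆X qr≤ =
      (normaliseCombination-sat c X<k _ _ ×-⇔ normaliseCombination-sat c′ X<k _ _)
      ⇔-∘ NF.∧ᵐ-sat 𝔸 (normaliseCombination c X<k _ _) (normaliseCombination c′ X<k _ _)
    normaliseCombination-sat (c ∨ c′) X<k ⊆X qr≤ =
      (normaliseCombination-sat c X<k _ _ ⊎-⇔ normaliseCombination-sat c′ X<k _ _)
      ⇔-∘ NF.++-sat 𝔸 (normaliseCombination c X<k _ _) (normaliseCombination c′ X<k _ _)

    normaliseGenerator-sat : ∀ {α} {φ : Formula σ} (g : GeneratorOf σ d q k φ)
      (X<k : All (_< k) X) (⊆X : free φ ⊆ X) (qr≤ : qr φ ≤ m) →
      (𝔸 , α ⊩ⁿ normaliseGenerator g X<k ⊆X qr≤) ⇔ (𝔸 , α ⊨ φ)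
    normaliseGenerator-sat {φ = φ} (lower p _) X<k ⊆X qr≤ =
      normalise-sat _ φ p (All-<-suc X<k) ⊆X qr≤ ⇔-∘ mk⇔ Any.map⁻ Any.map⁺
    normaliseGenerator-sat (dist _ _ _) X<k ⊆X qr≤ = NF.right-sat 𝔸 _
    normaliseGenerator-sat {k = k} {α = α} (exNear {i} {n} {ψ} i<k n≤ p) X<k ⊆X (s≤s qr≤) =
      ⇔-sym (exNear-sat 𝔸 ψ i<k)
      ⇔-∘ ((∃-⇔ λ a → ⇔-id _ ×-⇔
             normalise-sat _ ψ p (ℕ.≤-refl ∷ All-<-suc X<k) (exNear-body {i = i} {n} ψ ⊆X) qr≤)
      ⇔-∘ (any-∃ ms (λ (s , l) → mk⇔
             (λ (hs , hl) → let a , δ , hl′ = to (exNear-sat 𝔸 ⟦ l ⟧ i<k) hl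
                            in a , δ , to (sentence-sat s) hs , hl′)
             (λ (a , δ , hs , hl) →
               to (sentence-sat s) hs , from (exNear-sat 𝔸 ⟦ l ⟧ i<k) (a , δ , hl)))
      ⇔-∘ mk⇔ Any.map⁻ Any.map⁺))
      where ms = normalise _ ψ p (ℕ.≤-refl ∷ All-<-suc X<k) (exNear-body {i = i} {n} ψ ⊆X) qr≤
    normaliseGenerator-sat {k = k} {α = α} (exAny {ψ} p) X<k ⊆X (s≤s qr≤) = mk⇔ forth back
      where
      ms = normalise _ ψ p (ℕ.≤-refl ∷ All-<-suc X<k) (free-body ψ ⊆X) qr≤

      rec : ∀ {a} → (𝔸 , α [ k ↦ a ] ⊩ⁿ ms) ⇔ (𝔸 , α [ k ↦ a ] ⊨ ψ)
      rec = normalise-sat _ ψ p (ℕ.≤-refl ∷ All-<-suc X<k) (free-body ψ ⊆X) qr≤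

      forth : _ → ∃[ a ] (𝔸 , α [ k ↦ a ] ⊨ ψ)
      forth h with find (Any.concatMap⁻ _ {xs = ms} h)
      ... | (s , l) , sl∈ , h′ with to (NF.∧ᵐ-sat 𝔸 (NF.left _) (eliminate X<k l)) h′
      ... | hs , hl with to (eliminate-sat 𝔸 X<k l) hl
      ... | a , hl′ = a , to rec (lose sl∈ (to (sentence-sat s) (to (NF.left-sat 𝔸 _) hs) , hl′))

      back : ∃[ a ] (𝔸 , α [ k ↦ a ] ⊨ ψ) → _
      back (a , h) = Any.concatMap⁺ _ (Any.map
        (λ {(s , l)} (hs , hl) → from (NF.∧ᵐ-sat 𝔸 (NF.left _) (eliminate X<k l))
          (from (NF.left-sat 𝔸 _) (to (sentence-sat s) hs) , from (eliminate-sat 𝔸 X<k l) (a , hl)))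
        (from rec h))

-- Leaves of the normal form and their bounds

FO⁺-FreeIn : ∀ q {φ : Formula σ} → FO⁺ q k d φ → FreeIn k φ
FO⁺-FreeIn zero    (_ , free<k , _) = free<k
FO⁺-FreeIn (suc q) (free<k , _)     = free<k

LocalLeaf : (σ : Signature) (d q k m : ℕ) → Formula σ → Set₁
LocalLeaf σ d q k m χ = LocalIn q k d χ × qr χ ≤ m × IsLocal (r₁ q k d) χ

module _ {σ : Signature} where
  open BasicLocalSentence

  SentenceLeaf : (d q k m : ℕ) → Formula σ → Set₁
  SentenceLeaf d q k m χ = Σ[ s ∈ BasicLocalSentence q k d χ ]
    (innerRank s < m × innerRadius s ≤ r₁ (q ∸ 1) (suc k) d × width s ≤ k + q ×
     innerDistance s ≤ r₁ q k d + 2 * r₁ (q ∸ 1) (suc k) d)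

  -- Both levels have the same bound on the width, as `suc k + q = k + suc q`. By `r₁-double` the
  -- old bound on the distance is at most `2 * R`, the second summand of the new one.
  raiseLeaf : ∀ q {χ} → m ≤ m′ → SentenceLeaf d q (suc k) m χ → SentenceLeaf d (suc q) k m′ χ
  raiseLeaf zero    m≤ (s , _) = contradiction (q>0 s) λ ()
  raiseLeaf {d = d} {k} (suc q) m≤ (s , rank , radius , width≤ , distance) =
    record
      { q>0 = s≤s z≤n ; ys = ys s ; ys-unique = ys-unique s ; r = r s ; r̃ = r̃ s ; λ₁ = λ₁ s
      ; r̃≤r = r̃≤r s ; ℓ≥1 = ℓ≥1 s ; λ₁-free = λ₁-free s ; λ₁-local = λ₁-local s ; shape = shape s
      ; λ₁∈FO⁺ = λ₁<k , leaf (lower (λ₁∈FO⁺ s) λ₁<k)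
      } ,
    ℕ.<-≤-trans rank m≤ ,
    ℕ.≤-trans radius (r₁-step q (s≤s z≤n)) ,
    subst (width s ≤_) (sym (ℕ.+-suc k (suc q))) width≤ ,
    (begin
      innerDistance s              ≤⟨ distance ⟩
      R + 2 * r₁ q (suc (suc k)) d ≤⟨ ℕ.+-monoʳ-≤ R (r₁-double q (s≤s z≤n)) ⟩
      R + R                        ≡⟨ cong (R +_) (ℕ.+-identityʳ R) ⟨
      2 * R                        ≤⟨ ℕ.m≤n+m (2 * R) (r₁ (suc (suc q)) k d) ⟩
      r₁ (suc (suc q)) k d + 2 * R ∎)
    where
    open ℕ.≤-Reasoning
    R = r₁ (suc q) (suc k) d
    λ₁<k : FreeIn (suc k) (λ₁ s)
    λ₁<k = All.tabulate λ x∈ → All.lookup {P = _< suc k} (s≤s z≤n ∷ []) (λ₁-free s x∈)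

  -- The inner distance is largest for `n = 0`, where it equals `R + 2 * R′` with `R = 4 * k * R′`;
  -- the width is largest for `n = k`, where it is `suc k`.
  basicLeaf : ∀ {n} → n ≤ k → (l : Bounded σ d q (suc k) m (x₁ ∷ [])) →
    SentenceLeaf d (suc q) k (suc m) (scattered (upTo (suc n)) (scatterRadius q k d n) ⟦ l ⟧)
  basicLeaf {k = k} {d} {q} {n = n} n≤k l =
    record
      { q>0 = s≤s z≤n ; ys = upTo (suc n) ; ys-unique = upTo⁺ (suc n)
      ; r = scatterRadius q k d n ; r̃ = R′ ; λ₁ = ⟦ l ⟧
      ; r̃≤r = ℕ.m≤n*m R′ (suc (2 * (k ∸ n))) ; ℓ≥1 = s≤s z≤n
      ; λ₁∈FO⁺ = ⟦⟧-FO⁺ l (s≤s z≤n ∷ []) ; λ₁-free = ⟦⟧-free l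
      ; λ₁-local = ⟦⟧-local l (s≤s z≤n ∷ []) ; shape = refl
      } ,
    s≤s (⟦⟧-qr l) ,
    ℕ.≤-refl ,
    (begin
      length (upTo (suc n)) ≡⟨ List.length-upTo (suc n) ⟩
      suc n                 ≤⟨ s≤s n≤k ⟩
      suc k                 ≤⟨ s≤s (ℕ.m≤m+n k q) ⟩
      suc (k + q)           ≡⟨ ℕ.+-suc k q ⟨
      k + suc q             ∎) ,
    (begin
      2 * (suc (2 * (k ∸ n)) * R′)  ≡⟨ expand (k ∸ n) R′ ⟩
      4 * (k ∸ n) * R′ + 2 * R′     ≤⟨ ℕ.+-monoˡ-≤ (2 * R′)
                                         (ℕ.*-monoˡ-≤ R′ (ℕ.*-monoʳ-≤ 4 (ℕ.m∸n≤m k n))) ⟩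
      4 * k * R′ + 2 * R′           ∎)
    where
    open ℕ.≤-Reasoning
    R′ = r₁ q (suc k) d
    expand : ∀ t r → 2 * (suc (2 * t) * r) ≡ 4 * t * r + 2 * r
    expand = solve 2 (λ t r → con 2 :* ((con 1 :+ con 2 :* t) :* r) :=
                              con 4 :* t :* r :+ con 2 :* r) refl
      where open +-*-Solver

  Leaf : (d q k m : ℕ) → Formula σ → Set₁
  Leaf d q k m χ = LocalLeaf σ d q k m χ ⊎ SentenceLeaf d q k m χ

  localLeaf : (l : Bounded σ d q k m X) → All (_< k) X → Leaf d q k m ⟦ l ⟧
  localLeaf l X<k = inj₁ ((⟦⟧-FO⁺ l X<k , _ , ⟦⟧-local l X<k) , ⟦⟧-qr l , ⟦⟧-local l X<k)

  -- `true` is not a basic local sentence; these leaves are set aside here and become local formulas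
  -- in `disjunctionCombination`.
  sentenceCombination : (s : Sentence σ d q k m) →
    BooleanCombination (λ χ → χ ≡ true ⊎ SentenceLeaf d q k m χ) ⟦ s ⟧ˢ
  sentenceCombination true        = leaf (inj₁ refl)
  sentenceCombination (not s)     = not (sentenceCombination s)
  sentenceCombination (s ∧ s′)    = sentenceCombination s ∧ sentenceCombination s′
  sentenceCombination (lower {q = q} m≤ s) =
    mapCombination (Sum.map₂ (raiseLeaf q m≤)) (sentenceCombination s)
  sentenceCombination (basic n≤k l) = leaf (inj₂ (basicLeaf n≤k l))

  disjunction : NormalForm σ d q k m X → Formula σ
  disjunction []             = not true
  disjunction ((s , l) ∷ ms) = (⟦ s ⟧ˢ ∧ ⟦ l ⟧) ∨ disjunction ms

  disjunction-sat : (𝔸 : Structure σ) {α : Var → Carrier 𝔸} (ms : NormalForm σ d q k m X) →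
                    (𝔸 , α ⊨ disjunction ms) ⇔ (𝔸 , α ⊩ⁿ ms)
  disjunction-sat 𝔸 []       = mk⇔ (λ h → contradiction tt h) (λ ())
  disjunction-sat 𝔸 (_ ∷ ms) = mk⇔ Any.fromSum Any.toSum ⇔-∘ (⇔-id _ ⊎-⇔ disjunction-sat 𝔸 ms)

  disjunction-free : (ms : NormalForm σ d q k m X) → free (disjunction ms) ⊆ X
  disjunction-free ((s , l) ∷ ms) x∈ with ∈-++⁻ (free ⟦ s ⟧ˢ ++ free ⟦ l ⟧) x∈
  ... | inj₂ x∈ms = disjunction-free ms x∈ms
  ... | inj₁ x∈sl with ∈-++⁻ (free ⟦ s ⟧ˢ) x∈sl
  ...   | inj₁ x∈s = contradiction x∈s (sentence-closed s)
  ...   | inj₂ x∈l = ⟦⟧-free l x∈l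

  disjunctionCombination : (ms : NormalForm σ d q k m X) → All (_< k) X →
                           BooleanCombination (Leaf d q k m) (disjunction ms)
  disjunctionCombination {d = d} {q} {k} {m} {X} ms X<k = go ms
    where
    trueLeaf : Leaf d q k m true
    trueLeaf = localLeaf {X = X} true X<k
    go : (ms : NormalForm σ d q k m X) → BooleanCombination (Leaf d q k m) (disjunction ms)
    go []             = not (leaf trueLeaf)
    go ((s , l) ∷ ms) =
      (mapCombination Sum.[ (λ { refl → trueLeaf }) , inj₂ ]′ (sentenceCombination s)
        ∧ leaf (localLeaf l X<k)) ∨ go ms

  -- A valid formula in which every variable of X occurs.
  mention : (X : List Var) → Bounded σ d q k m X
  mention X = ⋀ᵇ (map (λ (_ , x∈) → equal x∈ x∈) (allMembers X))

  mention-sat : (𝔸 : Structure σ) {α : Var → Carrier 𝔸} (X : List Var) →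
                𝔸 , α ⊨ ⟦ mention {d = d} {q} {k} {m} X ⟧
  mention-sat {d} {q} {k} {m} 𝔸 X =
    from (⋀ᵇ-sat 𝔸 {d = d} {q} {k} {m} _) (All.map⁺ (All.universal (λ _ → refl) (allMembers X)))

  ⋀ᵇ-free : {l : Bounded σ d q k m X} {ls : List (Bounded σ d q k m X)} →
            l ∈ ls → free ⟦ l ⟧ ⊆ free ⟦ ⋀ᵇ ls ⟧
  ⋀ᵇ-free (here refl) x∈ = ∈-++⁺ˡ x∈
  ⋀ᵇ-free {ls = l′ ∷ _} (there l∈) x∈ = ∈-++⁺ʳ (free ⟦ l′ ⟧) (⋀ᵇ-free l∈ x∈)

  mention-free : X ⊆ free ⟦ mention {d = d} {q} {k} {m} X ⟧
  mention-free {X = X} {d} {q} {k} {m} x∈ =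
    ⋀ᵇ-free {d = d} {q} {k} {m} {l = equal x∈ x∈} (∈-map⁺ _ (∈-allMembers x∈)) (here refl)

  forgetBounds : ∀ {χ} → Leaf d q k m χ → LocalIn q k d χ ⊎ BasicLocalSentence q k d χ
  forgetBounds = Sum.map proj₁ proj₁

-- The type of the normal form only keeps its free variables within `free φ`. The second conjunct
-- yields the converse inclusion without tracking variables through the construction.
gaifman : (φ : Formula σ) → ∀ q k d → FO⁺ q k d φ → Formula σ
gaifman φ q k d p =
  disjunction (normalise {m = qr φ} q φ p (FO⁺-FreeIn q p) id ℕ.≤-refl) ∧
  ⟦ mention {d = d} {q} {k} {qr φ} (free φ) ⟧

GaifmanSpec : (φ ψ : Formula σ) (q k d : ℕ) → Set₁
GaifmanSpec φ ψ q k d =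
  φ ≣ ψ ×
  (Σ[ N ∈ GaifmanNormalForm q k d ψ ]
    (free ψ ∼[ set ] free φ ×
     (OuterRank≤ N (qr φ) × InnerRank< N (qr φ)) ×
     (OuterRadius≤ N (r₁ q k d) × InnerRadius≤ N (r₁ (q ∸ 1) (suc k) d)) ×
     (Width≤ N (k + q) ×
      InnerDistance≤ N (r₁ q k d + 2 * r₁ (q ∸ 1) (suc k) d))))

gaifman-spec : (φ : Formula σ) → ∀ q k d (p : FO⁺ q k d φ) → GaifmanSpec φ (gaifman φ q k d p) q k d
gaifman-spec {σ} φ q k d p =
  (λ 𝔸 α → ⇔-sym (normalise-sat 𝔸 q φ p free<k id ℕ.≤-refl
                    ⇔-∘ (disjunction-sat 𝔸 ms
                    ⇔-∘ mk⇔ proj₁ (_, mention-sat 𝔸 (free φ))))) ,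
  mapCombination forgetBounds c ,
  mk⇔ (Sum.[ disjunction-free ms , ⟦⟧-free pad ]′ ∘ ∈-++⁻ (free (disjunction ms)))
      (∈-++⁺ʳ (free (disjunction ms)) ∘ mention-free) ,
  (allLeaves-map (λ { (inj₁ (_ , rank , _)) → rank ; (inj₂ _) → tt }) c ,
   allLeaves-map (λ { (inj₁ _) → tt ; (inj₂ (_ , rank , _)) → rank }) c) ,
  (allLeaves-map (λ { (inj₁ (_ , _ , local)) → local ; (inj₂ _) → tt }) c ,
   allLeaves-map (λ { (inj₁ _) → tt ; (inj₂ (_ , _ , radius , _)) → radius }) c) ,
  allLeaves-map (λ { (inj₁ _) → tt ; (inj₂ (_ , _ , _ , width , _)) → width }) c ,
  allLeaves-map (λ { (inj₁ _) → tt ; (inj₂ (_ , _ , _ , _ , distance)) → distance }) c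
  where
  free<k = FO⁺-FreeIn q p
  ms     = normalise {m = qr φ} q φ p free<k id ℕ.≤-refl
  pad    = mention {d = d} {q} {k} {qr φ} (free φ)

  c : BooleanCombination (Leaf d q k (qr φ)) (gaifman φ q k d p)
  c = disjunctionCombination ms free<k ∧ leaf (localLeaf pad free<k)

corollary16 : (σ : Signature) →
    Σ[ nf ∈ (Formula σ → ℕ → ℕ → ℕ → Formula σ) ]
    ((φ : Formula σ) (q k d : ℕ) → FO⁺ q k d φ →
    φ ≣ nf φ q k d ×
    (Σ[ N ∈ GaifmanNormalForm q k d (nf φ q k d) ]
    (free (nf φ q k d) ∼[ set ] free φ ×
    (OuterRank≤ N (qr φ) × InnerRank< N (qr φ)) ×
    (OuterRadius≤ N (r₁ q k d) × InnerRadius≤ N (r₁ (q ∸ 1) (suc k) d)) ×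
    (Width≤ N (k + q) ×
    InnerDistance≤ N (r₁ q k d + 2 * r₁ (q ∸ 1) (suc k) d)))))
corollary16 σ = (λ φ q k d → nf φ (FO⁺? q k d φ)) , λ φ q k d p → nf-spec φ (FO⁺? q k d φ) p
  where
  nf : ∀ {q k d} φ → Dec (FO⁺ {σ} q k d φ) → Formula σ
  nf φ (yes p) = gaifman φ _ _ _ p
  -- A default value: the specification is claimed only for formulas in `FO⁺ q k d`.
  nf φ (no _)  = φ

  nf-spec : ∀ {q k d} φ (dec : Dec (FO⁺ {σ} q k d φ)) → FO⁺ q k d φ → GaifmanSpec φ (nf φ dec) q k d
  nf-spec φ (yes p) _ = gaifman-spec φ _ _ _ p
  nf-spec φ (no ¬p) p = contradiction p ¬p
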